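{- For every $\epsilon>0$, no DPTM solves Dominating Set on a tree, path or treedepth decomposition of width/depth $k$ with space bounded by $O\big((3-\epsilon)^k\log n\big)$. (This holds for each of the three types of decomposition.)
   Context: All graphs are finite and simple; logarithms are base two. Dominating Set: given a graph $G$ and an integer $\xi$, decide whether $G$ has a dominating set of size at most $\xi$, i.e. a set $S\subseteq V(G)$ with $|S|\le\xi$ such that every vertex is in $S$ or has a neighbor in $S$. Tree and path decompositions and their width are the standard notions. Treedepth decomposition: a treedepth decomposition of a graph $G$ is a rooted forest $F$ with vertex set $V(G)$ such that for every edge $uv\in E(G)$ either $u$ is an ancestor of $v$ in $F$ or vice versa. Its depth is its height, counted as the number of vertices on a longest root-to-leaf path. DP decision problem: let $\Pi$ be a decision problem on graphs with instances $(G,\xi)$, where $\xi$ encodes the non-graph part of the input. Let $T$ be a tree, path or treedepth decomposition of $G$ of width/depth $k$. Fix an encoding $\hat T$ of $T$ that lists the separators provided by the decomposition in the order in which they are normally visited in a dynamic programming algorithm (post-order depth-first traversal of the bags/nodes of the decomposition) and that additionally encodes the edges of $G$ contained in a separator using $O(k\log k)$ bits per bag. Then $(k,\hat T,\xi)$ is a well-formed instance of the DP decision problem $\Pi_{\mathrm{DP}}$; it is a yes-instance iff $(G,\xi)\in\Pi$. DPTM: a dynamic programming Turing machine is a Turing machine with a read-only input tape whose head moves only in one direction, and a separate working tape. It accepts as inputs well-formed instances of some DP decision problem. Its space is the space used on the working tape. A DPTM solves $\Pi$ on decompositions of a given type if it decides the corresponding $\Pi_{\mathrm{DP}}$. Here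 $n$ is the size and $k$ the width/depth of the decomposition given as input. -}

module Defs where

open import Data.Bool.Base using (Bool; true; false)
open import Data.Fin.Base using (Fin; zero)
open import Data.Fin.Subset using (Subset; _∈_; _∪_; _─_; ⁅_⁆; ∣_∣; ⊥)
open import Data.Integer.Base as ℤ using (ℤ; +_)
open import Data.List.Base using (List; []; _∷_; _++_; concatMap; foldr; length; map)
open import Data.List.Membership.Propositional using () renaming (_∈_ to _∈ˡ_)
open import Data.List.Relation.Unary.All using (All)
open import Data.Maybe.Base using (Maybe; just; nothing)
open import Data.Nat.Base using (ℕ; zero; suc; pred; _+_; _*_; _⊔_; _≤_)
open import Data.Nat.Logarithm using (⌈log₂_⌉)
open import Data.Product.Base using (Σ; ∃; _×_; _,_)
open import Data.Product using (∃!)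
open import Data.Rational.Base as ℚ using (ℚ)
open import Data.Sum.Base using (_⊎_; inj₁; inj₂)
open import Data.Vec.Base using (Vec; tabulate)
open import Relation.Binary.Construct.Closure.Equivalence using (EqClosure)
open import Relation.Binary.Construct.Closure.ReflexiveTransitive using (Star)
open import Relation.Binary.PropositionalEquality using (_≡_)
open import Relation.Nullary.Reflects using (Reflects)
import Algebra.Definitions.RawSemiring ℚ.+-*-rawSemiring as ℚ-Semiring

------------------------------------------------------------------------
-- Graphs and Dominating Set

record Graph (n : ℕ) : Set where
  field
    adj    : Fin n → Fin n → Bool
    adj-sym    : ∀ u v → adj u v ≡ adj v u
    adj-irrefl : ∀ v → adj v v ≡ false

  Adj : Fin n → Fin n → Set
  Adj u v = adj u v ≡ true

open Graph public

Problem : Set₁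
Problem = ∀ {n} → Graph n → ℤ → Set

DominatingSet : Problem
DominatingSet {n} G ξ =
  ∃ λ (S : Subset n) →
    + ∣ S ∣ ℤ.≤ ξ × (∀ v → v ∈ S ⊎ ∃ λ u → u ∈ S × Adj G v u)

------------------------------------------------------------------------
-- Ordered rooted forests

data Tree (A : Set) : Set where
  node : A → List (Tree A) → Tree A

Forest : Set → Set
Forest A = List (Tree A)

rootLabel : ∀ {A} → Tree A → A
rootLabel (node a _) = a

-- A node is a position, so different nodes may carry the same label.
data Node {A : Set} : Forest A → Set where
  root  : ∀ {t F} → t ∈ˡ F → Node F
  below : ∀ {a F G} → node a G ∈ˡ F → Node G → Node F

label : ∀ {A} {F : Forest A} → Node F → A
label (root {t} _)  = rootLabel t
label (below _ x)   = label x

data Parent {A : Set} : {F : Forest A} → Node F → Node F → Set where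
  top  : ∀ {a t} {F G : Forest A} {i : node a G ∈ˡ F} {j : t ∈ˡ G} →
         Parent (root i) (below i (root j))
  down : ∀ {a} {F G : Forest A} {i : node a G ∈ˡ F} {x y : Node G} →
         Parent x y → Parent (below i x) (below i y)

Ancestor : ∀ {A} {F : Forest A} → Node F → Node F → Set
Ancestor = Star Parent

height : ∀ {A} → Forest A → ℕ
height []             = 0
height (node _ F ∷ G) = suc (height F) ⊔ height G

postorder : ∀ {A} → Forest A → List A
postorder []             = []
postorder (node a F ∷ G) = postorder F ++ a ∷ postorder G

data IsPath {A : Set} : Tree A → Set where
  leaf : ∀ {a} → IsPath (node a [])
  step : ∀ {a t} → IsPath t → IsPath (node a (t ∷ []))

------------------------------------------------------------------------
-- Decompositions

-- The tree carries a root and an order on children; these only determine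
-- the order of the depth-first traversal.
record TreeDecomposition {n} (G : Graph n) : Set where
  field
    tree : Tree (Subset n)

  bags : Forest (Subset n)
  bags = tree ∷ []

  -- Adjacent tree nodes whose bags both contain v.
  Link : Fin n → Node bags → Node bags → Set
  Link v x y = Parent x y × v ∈ label x × v ∈ label y

  field
    covers-vertices : ∀ v → ∃ λ (x : Node bags) → v ∈ label x
    covers-edges    : ∀ u v → Adj G u v →
                      ∃ λ (x : Node bags) → u ∈ label x × v ∈ label x
    connected       : ∀ v (x y : Node bags) → v ∈ label x → v ∈ label y →
                      EqClosure (Link v) x y

-- The tree is a path rooted at one of its ends.
record PathDecomposition {n} (G : Graph n) : Set where
  field
    treeDecomposition : TreeDecomposition G
    isPath            : IsPath (TreeDecomposition.tree treeDecomposition)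

record TreedepthDecomposition {n} (G : Graph n) : Set where
  field
    forest : Forest (Fin n)
    once   : ∀ v → ∃! _≡_ λ (x : Node forest) → label x ≡ v
    edges  : ∀ (x y : Node forest) → Adj G (label x) (label y) →
             Ancestor x y ⊎ Ancestor y x

data Kind : Set where
  tree path treedepth : Kind

Decomposition : Kind → ∀ {n} → Graph n → Set
Decomposition tree      = TreeDecomposition
Decomposition path      = PathDecomposition
Decomposition treedepth = TreedepthDecomposition

-- Each vertex is replaced by the set of its ancestors, itself included;
-- A collects the ancestors of the forest.
rootPaths : ∀ {n} → Subset n → Forest (Fin n) → Forest (Subset n)
rootPaths A []             = []
rootPaths A (node v F ∷ G) =
  node (A ∪ ⁅ v ⁆) (rootPaths (A ∪ ⁅ v ⁆) F) ∷ rootPaths A G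

separators : ∀ τ {n} {G : Graph n} → Decomposition τ G → Forest (Subset n)
separators tree      D = TreeDecomposition.bags D
separators path      D =
  TreeDecomposition.bags (PathDecomposition.treeDecomposition D)
separators treedepth D = rootPaths ⊥ (TreedepthDecomposition.forest D)

maxBag : ∀ {n} → Forest (Subset n) → ℕ
maxBag F = foldr _⊔_ 0 (map ∣_∣ (postorder F))

-- Width (largest bag minus one), or depth (number of vertices on a longest
-- root-to-leaf path).
width : ∀ τ {n} {G : Graph n} → Decomposition τ G → ℕ
width tree      D = pred (maxBag (separators tree D))
width path      D = pred (maxBag (separators path D))
width treedepth D = height (TreedepthDecomposition.forest D)

------------------------------------------------------------------------
-- Instances of DP decision problems and their encodings

record Instance (τ : Kind) : Set where
  field
    {order} : ℕ
    graph   : Graph order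
    decomp  : Decomposition τ graph
    ξ       : ℤ

  seps : Forest (Subset order)
  seps = separators τ decomp

  k : ℕ
  k = width τ decomp

  -- The number of bags (for treedepth: of nodes).
  size : ℕ
  size = length (postorder seps)

  content : Σ ℕ λ n → Forest (Subset n) × Vec (Vec Bool n) n × ℤ
  content =
    order , seps , tabulate (λ u → tabulate (λ v → adj graph u v)) , ξ

-- What a traversal sees at a node: its separator, that of its parent
-- (empty at a root), and those of its children.
record Visit (n : ℕ) : Set where
  constructor visit
  field
    parent   : Subset n
    bag      : Subset n
    children : List (Subset n)

visits : ∀ {n} → Subset n → Forest (Subset n) → List (Visit n)
visits P []             = []
visits P (node X F ∷ G) =
  visits X F ++ visit P X (map rootLabel F) ∷ visits P G

AgreeOn : ∀ {n} → Subset n → Graph n → Graph n → Set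
AgreeOn X G H = ∀ u v → u ∈ X → v ∈ X → adj G u v ≡ adj H u v

-- The encoding of (k , T̂ , ξ) is an arbitrary one of the following shape: k,
-- then in post-order for each node its separator and the edges inside it,
-- then ξ.
--
-- A bound of O(k log k) on the edge code of every single bag is impossible
-- for unrestricted tree decompositions, as one bag may contain an arbitrary
-- graph on k + 1 vertices. It is possible if each edge is listed at the
-- topmost bag containing it and no bag has more than O(1) vertices missing
-- from its parent, as is always the case for treedepth decompositions and
-- for nice tree decompositions. The bound below is O(k log k) for such bags
-- and grows with the number of missing vertices otherwise.
record Encoding (τ : Kind) : Set where
  field
    alphabet : ℕ

  Word : Set
  Word = List (Fin alphabet)

  field
    paramCode : ℕ → Word
    sepCode   : ∀ {n} → ℕ → Visit n → Word
    edgeCode  : ∀ {n} → ℕ → Visit n → Graph n → Word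
    inputCode : ℤ → Word

  encode : Instance τ → Word
  encode I = let open Instance I in
    paramCode k
      ++ concatMap (λ V → sepCode k V ++ edgeCode k V graph) (visits ⊥ seps)
      ++ inputCode ξ

  field
    edges-local : ∀ {n} k (V : Visit n) (G H : Graph n) →
                  AgreeOn (Visit.bag V) G H → edgeCode k V G ≡ edgeCode k V H

    edges-constant : ℕ
    edges-short    : (I : Instance τ) → let open Instance I in
      All (λ V → length (edgeCode k V graph)
                   ≤ edges-constant * suc ∣ Visit.bag V ─ Visit.parent V ∣
                       * suc (k * ⌈log₂ k ⌉))
          (visits ⊥ seps)

    lossless : ∀ (I J : Instance τ) → encode I ≡ encode J →
               Instance.content I ≡ Instance.content J

------------------------------------------------------------------------
-- Dynamic programming Turing machines

data Move : Set where
  left stay right : Move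

data Action (states symbols : ℕ) : Set where
  halt : Bool → Action states symbols
  -- next state, symbol written, move of the working head, and whether the
  -- input head advances
  go   : Fin states → Fin (suc symbols) → Move → Bool → Action states symbols

-- Working symbol zero is the blank. The input symbol is nothing once the
-- whole input has been passed.
record DPTM (alphabet : ℕ) : Set where
  field
    states  : ℕ
    symbols : ℕ
    start   : Fin states
    δ       : Fin states → Maybe (Fin alphabet) → Fin (suc symbols) →
              Action states symbols

-- The visited part of a two-way infinite tape; the cells to the left of the
-- head are listed from right to left.
record Tape (Γ : ℕ) : Set where
  constructor tape
  field
    before : List (Fin (suc Γ))
    here   : Fin (suc Γ)
    after  : List (Fin (suc Γ))

  cells : ℕ
  cells = length before + suc (length after)

moveTape : ∀ {Γ} → Move → Tape Γ → Tape Γ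
moveTape left  (tape []       a rs)       = tape [] zero (a ∷ rs)
moveTape left  (tape (l ∷ ls) a rs)       = tape ls l (a ∷ rs)
moveTape stay  t                          = t
moveTape right (tape ls       a [])       = tape (a ∷ ls) zero []
moveTape right (tape ls       a (r ∷ rs)) = tape (a ∷ ls) r rs

module Run {alphabet} (M : DPTM alphabet) where
  open DPTM M

  -- The input tape is represented by its unread part, starting with the
  -- symbol under the head.
  record Config : Set where
    constructor config
    field
      state : Fin states
      input : List (Fin alphabet)
      work  : Tape symbols

  initial : List (Fin alphabet) → Config
  initial w = config start w (tape [] zero [])

  scanned : List (Fin alphabet) → Maybe (Fin alphabet)
  scanned []      = nothing
  scanned (a ∷ _) = just a

  advance : Bool → List (Fin alphabet) → List (Fin alphabet)
  advance true  (_ ∷ w) = w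
  advance _     w       = w

  next : Config → Bool ⊎ Config
  next (config q w (tape ls a rs)) with δ q (scanned w) a
  ... | halt b       = inj₁ b
  ... | go q′ a′ m d = inj₂ (config q′ (advance d w) (moveTape m (tape ls a′ rs)))

  _⟶*_ : Config → Config → Set
  _⟶*_ = Star (λ c d → next c ≡ inj₂ d)

  Outputs : List (Fin alphabet) → Bool → Set
  Outputs w b = ∃ λ c → initial w ⟶* c × next c ≡ inj₁ b

  SpaceAtMost : List (Fin alphabet) → ℚ → Set
  SpaceAtMost w s =
    ∀ c → initial w ⟶* c → + Tape.cells (Config.work c) ℚ./ 1 ℚ.≤ s

Solves : ∀ {τ} (E : Encoding τ) → DPTM (Encoding.alphabet E) → Problem → Set
Solves {τ} E M Π = (I : Instance τ) → let open Instance I in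
  ∃ λ b → Run.Outputs M (Encoding.encode E I) b × Reflects (Π graph ξ) b

-- Space O(f(k , n)): the bound need only hold for large k and n. (For n = 1
-- it could be zero, as it is for f(k , n) = 3 ^ k * log n.)
SpaceO : ∀ {τ} (E : Encoding τ) → DPTM (Encoding.alphabet E) →
         (ℕ → ℕ → ℚ) → Set
SpaceO {τ} E M f = ∃ λ (C : ℕ) → ∃ λ (N : ℕ) →
  (I : Instance τ) → let open Instance I in N ≤ k → N ≤ size →
  Run.SpaceAtMost M (Encoding.encode E I) ((+ C ℚ./ 1) ℚ.* f k size)

infixr 8 _^_
_^_ : ℚ → ℕ → ℚ
_^_ = ℚ-Semiring._^_

-- Rounding up changes log n by a factor of at most two for n ≥ 2.
log : ℕ → ℚ
log n = + ⌈log₂ n ⌉ ℚ./ 1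

{-# OPTIONS --safe #-}
module Submission where

open import Defs
open import Data.Integer.Base using (+_)
open import Data.Product.Base using (∃; _×_)
open import Data.Rational.Base using (ℚ; 0ℚ; _<_; _-_; _*_; _/_)
open import Relation.Nullary.Negation.Core using (¬_)

open import Algebra.Bundles using (CommutativeMonoid)
open import Data.Bool.Base using (Bool; true; false; if_then_else_)
import Data.Bool.Properties as Bool
open import Data.Fin.Base as Fin using (Fin; zero; suc; toℕ; combine; _↑ˡ_; finToFun; funToFin)
open import Data.Fin.Properties as Fin using (+↔⊎; *↔×)
open import Data.Fin.Subset using (Subset; _∈_; _∉_; _⊆_; _∪_; ⁅_⁆; ∣_∣; ⊥) renaming (_-_ to _∖_)
open import Data.Fin.Subset.Properties
  using (x∈p⇒∣p-x∣<∣p∣; x∈p∧x≢y⇒x∈p-y; x∈⁅x⁆; x∈⁅y⁆⇒x≡y; x∈p∪q⁺; x∈p∪q⁻; ∉⊥; ∣⊥∣≡0;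
         ∪-identityˡ; ∪-identityʳ)
open import Data.Integer.Base as ℤ using (-[1+_])
import Data.Integer.Properties as ℤ
open import Data.List.Base
  using (List; []; _∷_; _++_; map; foldr; length; lookup; tabulate; concatMap; filter; allFin)
open import Data.List.Membership.Propositional using () renaming (_∈_ to _∈ˡ_; _∉_ to _∉ˡ_)
open import Data.List.Membership.Propositional.Properties
  using (∈-++⁺ˡ; ∈-++⁺ʳ; ∈-++⁻; ∈-tabulate⁺; ∈-lookup; ∈-filter⁻)
import Data.List.Membership.DecPropositional as DecMembership
open import Data.List.Properties
  using (++-assoc; ++-identityʳ; length-++; map-++; concatMap-++; length-filter; length-tabulate;
         ∷-injective)
open import Data.List.Relation.Unary.All as All using (All; []; _∷_)
import Data.List.Relation.Unary.All.Properties as All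
open import Data.List.Relation.Unary.AllPairs using ([]; _∷_)
open import Data.List.Relation.Unary.Any using (here; there; index)
open import Data.List.Relation.Unary.Any.Properties using (lookup-index)
open import Data.List.Relation.Unary.Unique.Propositional using (Unique)
import Data.List.Relation.Unary.Unique.Propositional.Properties as Unique
open import Data.Maybe.Base using (just)
open import Data.Nat.Base as ℕ using (ℕ; zero; suc; pred; _+_; _⊔_; _≤_; z≤n; s≤s)
open import Data.Nat.DivMod using (m*n/n≡m; m/n*n≤m; /-monoˡ-≤)
open import Data.Nat.Logarithm using (⌈log₂_⌉; ⌈log₂⌉-mono-≤; ⌈log₂2^n⌉≡n)
import Data.Nat.Properties as ℕ
open import Data.Nat.Tactic.RingSolver using (solve-∀)
open import Data.Product.Base using (∃₂; _,_; proj₁; proj₂)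
open import Data.Product.Function.NonDependent.Propositional using (_×-↔_)
open import Data.Rational.Base as ℚ using (mkℚ; 1ℚ; NonNegative; nonNegative; nonPositive; toℚᵘ)
import Data.Rational.Properties as ℚ
open import Data.Rational.Unnormalised.Base as ℚᵘ using (mkℚᵘ; *≤*; *≡*)
import Data.Rational.Unnormalised.Properties as ℚᵘ
open import Data.Sum.Base as Sum using (_⊎_; inj₁; inj₂; [_,_]′)
open import Data.Sum.Function.Propositional using (_⊎-↔_)
open import Data.Sum.Properties using (inj₁-injective; inj₂-injective)
open import Data.Unit.Base using (⊤; tt)
open import Data.Vec.Base as Vec using (_∷_)
open import Function.Base using (_∘_; id)
open import Function.Bundles using (_↔_; Inverse; mk⇔)
open import Function.Construct.Composition using (_↔-∘_)
open import Function.Construct.Identity using (↔-id)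
open import Function.Construct.Symmetry using (↔-sym)
open import Function.Properties.Inverse using (↔⇒↣)
open import Relation.Binary.Construct.Closure.Equivalence as Eq using (EqClosure)
open import Relation.Binary.Construct.Closure.ReflexiveTransitive as Star using (_◅_; _◅◅_)
open import Relation.Binary.Construct.Closure.Symmetric using (fwd; bwd)
open import Relation.Binary.PropositionalEquality
  using (_≡_; _≢_; refl; sym; trans; cong; cong₂; subst; subst₂; module ≡-Reasoning)
open import Relation.Nullary.Decidable using (via-injection; dec-true; dec-false; does-⇔)
open import Relation.Nullary.Decidable.Core using (Dec; yes; no; does; map′; ¬?; _⊎-dec_)
open import Relation.Nullary.Negation.Core using (contradiction)
open import Relation.Nullary.Reflects using (Reflects; ofʸ; ofⁿ)

-- All instances share one elimination forest, hence one sequence of visits. A family L of codewords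
-- in {left, right, selected}^b only affects edges seen in the first part of the input, and a query
-- word r only edges seen in the second. The graph has a dominating set of size ξ iff r ∈ L, so the
-- machine must be in different configurations after the first part for different L. The codewords of
-- a fixed weight are an antichain of size at least 3^b / poly(b), whereas k = b + O(1) and the graph
-- has 2^O(b) vertices; the number of configurations within the alleged space is too small. (For
-- ε ≥ 3 the alleged space is not even positive when k is odd.)
--
-- The vertices are partitioned into ξ cells, each containing the closed neighbourhood of one of its
-- vertices. Hence a dominating set of size ξ selects exactly one vertex per cell, and finding it is
-- a constraint satisfaction problem with one variable per cell and one clause per vertex.

-- The input head never returns, so what has been read survives only in the state and the working
-- tape. Suppose a first part of the input can carry any of `2 ^ M` sets `L` of codewords, and a
-- second part a query testing membership of any one codeword. At the cut the machine has either
-- halted with an answer or crossed in some state with some tape, and these outcomes must differ for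
-- different `L`. With `s` cells there are only 2^O(s) outcomes, so `s` is at least linear in `M`,
-- up to an additive constant.
--
-- The graph stores the set behind `b = suc w` boundary vertices. These and two hubs form the top of
-- an elimination forest; below them hang one gadget per codeword and then one query gadget per
-- boundary vertex, all of constant height. The depth is thus `b + 9`, and postorder meets all
-- gadgets before all queries. Descendants of a vertex are consecutive in postorder, so the list of
-- ancestor sets in postorder is also a path decomposition, of width one less than the depth. Hence
-- one forest, one list of bags and one cut serve all three kinds of decomposition.
--
-- A budget of one vertex per cell turns domination into constraints. They force a single token `v`
-- with `L v`, turn its gadget on, and make its codeword at most the query word in the pointwise
-- order `lft` < `rgt` < `sel`. Conversely, a query equal to a codeword of `L` is satisfiable. Since
-- the constraints only give an inequality, the codewords must form an antichain: ternary words with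
-- one common digit sum, the sum being chosen by pigeonhole so that `M` is at least 3^w / (2w + 1).
--
-- For `3 - ε` nonnegative, pick a positive integer δ with `3 - ε` at most D/δ, where D = 3δ - 1. As
-- log n is O(w), the alleged space is at most a linear function of w times (D/δ)^w. But 3^w exceeds
-- (D/δ)^w by the factor (1 + 1/D)^w, which outgrows every polynomial. For `3 - ε` nonpositive, the
-- alleged space at odd width is nonpositive, while every configuration occupies a cell.

module Cut {alphabet} (M : DPTM alphabet) where
  open DPTM M
  open Run M

  private
    variable
      q : Fin states
      t : Tape symbols
      u w : List (Fin alphabet)
      b : Bool
      c d e : Config

  OutputsFrom : Config → Bool → Set
  OutputsFrom c b = ∃ λ d → c ⟶* d × next d ≡ inj₁ b

  after-steps : c ⟶* d → OutputsFrom d b → OutputsFrom c b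
  after-steps r (e , s , h) = e , r ◅◅ s , h

  -- Determinism: a halting run from `c` must pass through `d`.
  from-reached : c ⟶* d → OutputsFrom c b → OutputsFrom d b
  from-reached Star.ε       o                     = o
  from-reached (x ◅ r) (_ , Star.ε , h)           with () ← trans (sym x) h
  from-reached (x ◅ r) (e , y ◅ s , h)
    with refl ← inj₂-injective (trans (sym x) y) = from-reached r (e , s , h)

  outputs-unique : ∀ {b b′} → OutputsFrom c b → OutputsFrom c b′ → b ≡ b′
  outputs-unique (_ , r , h) o with from-reached r o
  ... | _ , Star.ε , h′     = inj₁-injective (trans (sym h) h′)
  ... | _ , (x ◅ _) , _ with () ← trans (sym h) x

  data Outcome : Set where
    halted  : Bool → Outcome
    crossed : Fin states → Tape symbols → Outcome

  -- What the machine does on its way through a prefix u, whatever follows u.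
  Leads : List (Fin alphabet) → Fin states → Tape symbols → Outcome → Set
  Leads u q t (halted b)      = ∀ w → OutputsFrom (config q (u ++ w) t) b
  Leads u q t (crossed q′ t′) = ∀ w → config q (u ++ w) t ⟶* config q′ w t′

  Leads-step : ∀ {u′ q′ t′} →
    (∀ w → next (config q (u ++ w) t) ≡ inj₂ (config q′ (u′ ++ w) t′)) →
    ∀ o → Leads u′ q′ t′ o → Leads u q t o
  Leads-step s (halted b)    l w = after-steps (s w ◅ Star.ε) (l w)
  Leads-step s (crossed _ _) l w = s w ◅ l w

  -- The halting run bounds the recursion, which follows it until the machine halts or the prefix is
  -- used up. Every step before that sees only letters of `u`, so it is the same for every
  -- continuation.
  outcome : ∀ u q t → OutputsFrom (config q (u ++ w) t) b → ∃ (Leads u q t)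
  outcome {w = w} u q t (d , r , h) = scan u q t r h
    where
    scan : ∀ u q t → config q (u ++ w) t ⟶* d → next d ≡ inj₁ b → ∃ (Leads u q t)
    scan []      q t _ _ = crossed q t , λ _ → Star.ε
    scan (a ∷ u) q (tape ls x rs) r h with δ q (just a) x in eq
    scan (a ∷ u) q (tape ls x rs) r h | halt b′ =
      halted b′ , λ w → _ , Star.ε , halts w
      where
      halts : ∀ w → next (config q (a ∷ u ++ w) (tape ls x rs)) ≡ inj₁ b′
      halts w rewrite eq = refl
    scan (a ∷ u) q (tape ls x rs) Star.ε h | go _ _ _ _ rewrite eq with () ← h
    scan (a ∷ u) q (tape ls x rs) (s ◅ r) h | go q′ x′ m true
      rewrite eq with refl ← s
      with o , l ← scan u _ _ r h = o , Leads-step moves o l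
      where
      moves : ∀ w → next (config q (a ∷ u ++ w) (tape ls x rs)) ≡
                    inj₂ (config q′ (u ++ w) (moveTape m (tape ls x′ rs)))
      moves w rewrite eq = refl
    scan (a ∷ u) q (tape ls x rs) (s ◅ r) h | go q′ x′ m false
      rewrite eq with refl ← s
      with o , l ← scan (a ∷ u) _ _ r h = o , Leads-step moves o l
      where
      moves : ∀ w → next (config q (a ∷ u ++ w) (tape ls x rs)) ≡
                    inj₂ (config q′ (a ∷ u ++ w) (moveTape m (tape ls x′ rs)))
      moves w rewrite eq = refl

  -- The outcome determines the rest of the computation, so the answer carries over from one prefix
  -- to the other.
  same-output : ∀ {u v q t q′ t′} o → Leads u q t o → Leads v q′ t′ o →
    ∀ w {b} → OutputsFrom (config q (u ++ w) t) b →
    OutputsFrom (config q′ (v ++ w) t′) b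
  same-output (halted b) l l′ w o with refl ← outputs-unique (l w) o = l′ w
  same-output (crossed q t) l l′ w o = after-steps (l′ w) (from-reached (l w) o)

-- Counting tapes and outcomes

-- `zero` marks the positions past the end, so that words of all lengths up to `s` become functions
-- on `Fin s`.
padded : ∀ {γ} s → List (Fin γ) → Fin s → Fin (suc γ)
padded (suc s) []       _       = zero
padded (suc s) (x ∷ xs) zero    = suc x
padded (suc s) (x ∷ xs) (suc i) = padded s xs i

padded-injective : ∀ {γ} s (xs ys : List (Fin γ)) → length xs ≤ s → length ys ≤ s →
  (∀ i → padded s xs i ≡ padded s ys i) → xs ≡ ys
padded-injective s       []       []       _       _       _  = refl
padded-injective (suc s) []       (y ∷ ys) _       _       eq with () ← eq zero
padded-injective (suc s) (x ∷ xs) []       _       _       eq with () ← eq zero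
padded-injective (suc s) (x ∷ xs) (y ∷ ys) (s≤s p) (s≤s q) eq =
  cong₂ _∷_ (Fin.suc-injective (eq zero)) (padded-injective s xs ys p q (eq ∘ suc))

funToFin-injective : ∀ {m n} (f g : Fin m → Fin n) → funToFin f ≡ funToFin g → ∀ i → f i ≡ g i
funToFin-injective f g eq i =
  trans (sym (Fin.finToFun-funToFin f i))
    (trans (cong (λ x → finToFun x i) eq) (Fin.finToFun-funToFin g i))

funToFin-cong : ∀ {k n} {f g : Fin k → Fin n} → (∀ i → f i ≡ g i) → funToFin f ≡ funToFin g
funToFin-cong {zero}  _ = refl
funToFin-cong {suc k} e = cong₂ combine (e zero) (funToFin-cong (e ∘ suc))

wordIndex : ∀ {γ} s → List (Fin γ) → Fin (suc γ ℕ.^ s)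
wordIndex s xs = funToFin (padded s xs)

wordIndex-injective : ∀ {γ} s (xs ys : List (Fin γ)) → length xs ≤ s → length ys ≤ s →
  wordIndex s xs ≡ wordIndex s ys → xs ≡ ys
wordIndex-injective s xs ys p q eq = padded-injective s xs ys p q (funToFin-injective _ _ eq)

module _ {Γ : ℕ} where

  -- The base `2 + Γ` counts the tape symbols, blank included, and the padding symbol.
  tapeCount : ℕ → ℕ
  tapeCount s = suc Γ ℕ.* ((2 + Γ) ℕ.^ s ℕ.* (2 + Γ) ℕ.^ s)

  tapeIndex : ∀ s → Tape Γ → Fin (tapeCount s)
  tapeIndex s (tape ls a rs) = combine a (combine (wordIndex s ls) (wordIndex s rs))

  tapeIndex-injective : ∀ s t t′ → Tape.cells t ≤ s → Tape.cells t′ ≤ s →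
    tapeIndex s t ≡ tapeIndex s t′ → t ≡ t′
  tapeIndex-injective s (tape ls a rs) (tape ls′ a′ rs′) p q eq
    with refl , eq′ ← Fin.combine-injective a _ a′ _ eq
    with eqˡ , eqʳ ← Fin.combine-injective (wordIndex s ls) _ (wordIndex s ls′) _ eq′
    with refl ← wordIndex-injective s ls ls′ (ℕ.m+n≤o⇒m≤o (length ls) p) (ℕ.m+n≤o⇒m≤o (length ls′) q) eqˡ
       | refl ← wordIndex-injective s rs rs′
                  (ℕ.<⇒≤ (ℕ.m+n≤o⇒n≤o (length ls) p)) (ℕ.<⇒≤ (ℕ.m+n≤o⇒n≤o (length ls′) q)) eqʳ
    = refl

module Fooling {alphabet} (M : DPTM alphabet) where
  open DPTM M
  open Run M
  open Cut M

  outcomeCount : ℕ → ℕ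
  outcomeCount s = 2 + states ℕ.* tapeCount {symbols} s

  private
    bit : Bool → Fin 2
    bit false = zero
    bit true  = suc zero

    bit-injective : ∀ {a b} → bit a ≡ bit b → a ≡ b
    bit-injective {false} {false} _ = refl
    bit-injective {true}  {true}  _ = refl

    outcomeIndex : ∀ s → Outcome → Fin (outcomeCount s)
    outcomeIndex s (halted b)    = bit b ↑ˡ _
    outcomeIndex s (crossed q t) = suc (suc (combine q (tapeIndex s t)))

    Fits : ℕ → Outcome → Set
    Fits s (halted _)    = ⊤
    Fits s (crossed _ t) = Tape.cells t ≤ s

    outcomeIndex-injective : ∀ s o o′ → Fits s o → Fits s o′ →
      outcomeIndex s o ≡ outcomeIndex s o′ → o ≡ o′
    outcomeIndex-injective s (halted b) (halted b′) _ _ eq =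
      cong halted (bit-injective (Fin.↑ˡ-injective _ (bit b) (bit b′) eq))
    outcomeIndex-injective s (halted false) (crossed _ _) _ _ ()
    outcomeIndex-injective s (halted true)  (crossed _ _) _ _ ()
    outcomeIndex-injective s (crossed _ _) (halted false) _ _ ()
    outcomeIndex-injective s (crossed _ _) (halted true)  _ _ ()
    outcomeIndex-injective s (crossed q t) (crossed q′ t′) p p′ eq
      with refl , eq′ ← Fin.combine-injective q _ q′ _ (Fin.suc-injective (Fin.suc-injective eq))
      with refl ← tapeIndex-injective s t t′ p p′ eq′ = refl

  -- Two subsets with the same outcome get the same answer to every query.
  subsets≤outcomes : ∀ {m s} {R : Set}
    (prefix : (Fin m → Bool) → List (Fin alphabet)) (suffix : R → List (Fin alphabet))
    (query : Fin m → R) (r₀ : R) →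
    (∀ L r → ∃ λ b → Outputs (prefix L ++ suffix r) b) →
    (∀ L i b → Outputs (prefix L ++ suffix (query i)) b → b ≡ L i) →
    (∀ L c → initial (prefix L ++ suffix r₀) ⟶* c → Tape.cells (Config.work c) ≤ s) →
    2 ℕ.^ m ≤ outcomeCount s
  subsets≤outcomes {m} {s} prefix suffix query r₀ total correct space =
    Fin.injective⇒≤ {f = outcomeIndex s ∘ outcomeOf ∘ member} λ {x} {y} eq →
      same x y (outcomeIndex-injective s _ _ (fits (member x)) (fits (member y)) eq)
    where
    member : Fin (2 ℕ.^ m) → Fin m → Bool
    member x i with finToFun {2} x i
    ... | zero  = false
    ... | suc _ = true

    lead : ∀ L → ∃ (Leads (prefix L) start (tape [] zero []))
    lead L = outcome (prefix L) start _ (proj₂ (total L r₀))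

    outcomeOf : (Fin m → Bool) → Outcome
    outcomeOf L = proj₁ (lead L)

    fits : ∀ L → Fits s (outcomeOf L)
    fits L with lead L
    ... | halted _    , _ = tt
    -- The crossing tape is the same for every suffix, so a space bound for the one suffix
    -- `suffix r₀` suffices.
    ... | crossed _ _ , l = space L _ (l (suffix r₀))

    member-injective : ∀ x y → (∀ i → member x i ≡ member y i) → ∀ i →
      finToFun {2} {m} x i ≡ finToFun y i
    member-injective x y eq i with finToFun {2} x i | finToFun {2} y i | eq i
    ... | zero     | zero     | _ = refl
    ... | suc zero | suc zero | _ = refl

    same : ∀ x y → outcomeOf (member x) ≡ outcomeOf (member y) → x ≡ y
    same x y eq =
      trans (sym (Fin.funToFin-finToFin {m} {2} x))
        (trans (funToFin-cong (member-injective x y bits)) (Fin.funToFin-finToFin {m} {2} y))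
      where
      bits : ∀ i → member x i ≡ member y i
      bits i with b , o ← total (member x) (query i) =
        trans (sym (correct (member x) i b o)) (correct (member y) i b
          (same-output (outcomeOf (member x)) (proj₂ (lead (member x)))
            (subst (Leads _ _ _) (sym eq) (proj₂ (lead (member y)))) (suffix (query i)) o))

-- Cardinalities of subsets of Fin n

∣⁅x⁆∪p∣≤1+∣p∣ : ∀ {n} (x : Fin n) (p : Subset n) → ∣ ⁅ x ⁆ ∪ p ∣ ≤ suc ∣ p ∣
∣⁅x⁆∪p∣≤1+∣p∣ zero    (false ∷ p) = s≤s (ℕ.≤-reflexive (cong ∣_∣ (∪-identityˡ p)))
∣⁅x⁆∪p∣≤1+∣p∣ zero    (true ∷ p)  = s≤s (ℕ.m≤n⇒m≤1+n (ℕ.≤-reflexive (cong ∣_∣ (∪-identityˡ p))))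
∣⁅x⁆∪p∣≤1+∣p∣ (suc x) (false ∷ p) = ∣⁅x⁆∪p∣≤1+∣p∣ x p
∣⁅x⁆∪p∣≤1+∣p∣ (suc x) (true ∷ p)  = s≤s (∣⁅x⁆∪p∣≤1+∣p∣ x p)

image : ∀ {m n} → (Fin m → Fin n) → Subset n
image {zero}  f = ⊥
image {suc m} f = ⁅ f zero ⁆ ∪ image (f ∘ suc)

∣image∣≤ : ∀ {m n} (f : Fin m → Fin n) → ∣ image f ∣ ≤ m
∣image∣≤ {zero}  {n} f = ℕ.≤-reflexive (∣⊥∣≡0 n)
∣image∣≤ {suc m} f =
  ℕ.≤-trans (∣⁅x⁆∪p∣≤1+∣p∣ (f zero) (image (f ∘ suc))) (s≤s (∣image∣≤ (f ∘ suc)))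

∈-image : ∀ {m n} (f : Fin m → Fin n) i → f i ∈ image f
∈-image f zero    = x∈p∪q⁺ (inj₁ (x∈⁅x⁆ (f zero)))
∈-image f (suc i) = x∈p∪q⁺ (inj₂ (∈-image (f ∘ suc) i))

injective⇒≤∣∣ : ∀ {m n} (f : Fin m → Fin n) (p : Subset n) →
  (∀ {i j} → f i ≡ f j → i ≡ j) → (∀ i → f i ∈ p) → m ≤ ∣ p ∣
injective⇒≤∣∣ {zero}  f p inj mem = z≤n
injective⇒≤∣∣ {suc m} f p inj mem =
  ℕ.<-≤-trans (s≤s (injective⇒≤∣∣ (f ∘ suc) (p ∖ f zero) (Fin.suc-injective ∘ inj)
    λ i → x∈p∧x≢y⇒x∈p-y (mem (suc i)) λ eq → contradiction (inj eq) λ ()))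
    (x∈p⇒∣p-x∣<∣p∣ (mem zero))

-- Otherwise `y` could be removed: the rest would still meet all `m` cells with fewer than `m`
-- elements.
one-per-cell : ∀ {m n} (cell : Fin n → Fin m) (p : Subset n) → ∣ p ∣ ≤ m →
  (∀ c → ∃ λ x → x ∈ p × cell x ≡ c) → ∀ {x y} → x ∈ p → y ∈ p → cell x ≡ cell y → x ≡ y
one-per-cell {m} {n} cell p ∣p∣≤m hit {x} {y} x∈p y∈p same with x Fin.≟ y
... | yes x≡y = x≡y
... | no  x≢y = contradiction (ℕ.≤-trans (ℕ.<-≤-trans (x∈p⇒∣p-x∣<∣p∣ y∈p) ∣p∣≤m) m≤) (ℕ.<-irrefl refl)
  where
  hit′ : ∀ c → ∃ λ z → z ∈ p ∖ y × cell z ≡ c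
  hit′ c with z , z∈p , eq ← hit c with z Fin.≟ y
  ... | yes refl = x , x∈p∧x≢y⇒x∈p-y x∈p x≢y , trans same eq
  ... | no  z≢y  = z , x∈p∧x≢y⇒x∈p-y z∈p z≢y , eq

  m≤ : m ≤ ∣ p ∖ y ∣
  m≤ = injective⇒≤∣∣ (proj₁ ∘ hit′) (p ∖ y)
    (λ {c} {d} eq → trans (sym (proj₂ (proj₂ (hit′ c)))) (trans (cong cell eq) (proj₂ (proj₂ (hit′ d)))))
    (λ c → proj₁ (proj₂ (hit′ c)))

does⇒ : ∀ {A : Set} (A? : Dec A) → does A? ≡ true → A
does⇒ (yes a) _ = a

-- The state of a boundary vertex: dominated from the left, dominated from the right, or selected.
Digit : Set
Digit = Fin 3

pattern lft = zero
pattern rgt = suc zero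
pattern sel = suc (suc zero)

-- The gadget graph and its dominating sets

module Vertices (M b : ℕ) where

  V : Set
  V = Fin b ⊎ (Fin 2 ⊎ ((Fin M × (Fin 4 ⊎ (Fin b × Fin 3))) ⊎ (Fin b × Fin 2)))

  order : ℕ
  order = b + (2 + (M ℕ.* (4 + b ℕ.* 3) + b ℕ.* 2))

  abstract
    vertex : Fin order ↔ V
    vertex =
      (↔-id _ ⊎-↔ ((↔-id _ ⊎-↔ (((↔-id _ ×-↔ ((↔-id _ ⊎-↔ *↔×) ↔-∘ +↔⊎)) ↔-∘ *↔×) ⊎-↔ *↔×) ↔-∘ +↔⊎) ↔-∘ +↔⊎)) ↔-∘ +↔⊎

  Cell : Set
  Cell = Fin 1 ⊎ (Fin M ⊎ ((Fin M × Fin b) ⊎ Fin b))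

  cells : ℕ
  cells = 1 + (M + (M ℕ.* b + b))

  abstract
    cellIndex : Fin cells ↔ Cell
    cellIndex = (↔-id _ ⊎-↔ ((↔-id _ ⊎-↔ ((*↔× ⊎-↔ ↔-id _) ↔-∘ +↔⊎)) ↔-∘ +↔⊎)) ↔-∘ +↔⊎

pattern bnd i      = inj₁ i
pattern hub₀       = inj₂ (inj₁ zero)
pattern hub₁       = inj₂ (inj₁ (suc zero))
pattern token v    = inj₂ (inj₂ (inj₁ (v , inj₁ zero)))
pattern on v       = inj₂ (inj₂ (inj₁ (v , inj₁ (suc zero))))
pattern pin v      = inj₂ (inj₂ (inj₁ (v , inj₁ (suc (suc zero)))))
pattern off v      = inj₂ (inj₂ (inj₁ (v , inj₁ (suc (suc (suc zero))))))
pattern outer v i  = inj₂ (inj₂ (inj₁ (v , inj₂ (i , zero))))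
pattern middle v i = inj₂ (inj₂ (inj₁ (v , inj₂ (i , suc zero))))
pattern inner v i  = inj₂ (inj₂ (inj₁ (v , inj₂ (i , suc (suc zero)))))
pattern query₀ i   = inj₂ (inj₂ (inj₂ (i , zero)))
pattern query₁ i   = inj₂ (inj₂ (inj₂ (i , suc zero)))

pattern hubCell      = inj₁ zero
pattern switchCell v = inj₂ (inj₁ v)
pattern wireCell v i = inj₂ (inj₂ (inj₁ (v , i)))
pattern queryCell i  = inj₂ (inj₂ (inj₂ i))

module Gadgets {M b : ℕ} (code : Fin M → Fin b → Digit) where
  open Vertices M b public

  cell : V → Cell
  cell (bnd i)      = queryCell i
  cell hub₀         = hubCell
  cell hub₁         = hubCell
  cell (token _)    = hubCell
  cell (on v)       = switchCell v
  cell (pin v)      = switchCell v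
  cell (off v)      = switchCell v
  cell (outer v i)  = wireCell v i
  cell (middle v i) = wireCell v i
  cell (inner v i)  = wireCell v i
  cell (query₀ i)   = queryCell i
  cell (query₁ i)   = queryCell i

  -- Exactly one token v is selected, and only for v with L v. It allows on v to be selected instead
  -- of off v, which in turn allows the wires i of v with code v i = lft to select their outer end
  -- and dominate bnd i. Without off v, the wires with code v i = sel need bnd i to be selected.
  -- Edges point to the vertex that is higher in the elimination forest.
  data Edge (L : Fin M → Bool) (r : Fin b → Digit) : V → V → Set where
    token-hub₀    : ∀ {v} → L v ≡ true → Edge L r (token v) hub₀
    token-hub₁    : ∀ {v} → L v ≡ true → Edge L r (token v) hub₁
    pin-on        : ∀ {v} → Edge L r (pin v) (on v)
    off-token     : ∀ {v} → Edge L r (off v) (token v)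
    off-on        : ∀ {v} → Edge L r (off v) (on v)
    off-pin       : ∀ {v} → Edge L r (off v) (pin v)
    outer-bnd     : ∀ {v i} → code v i ≢ rgt → Edge L r (outer v i) (bnd i)
    outer-off     : ∀ {v i} → code v i ≡ sel → Edge L r (outer v i) (off v)
    middle-outer  : ∀ {v i} → code v i ≢ sel → Edge L r (middle v i) (outer v i)
    inner-middle  : ∀ {v i} → Edge L r (inner v i) (middle v i)
    inner-on      : ∀ {v i} → code v i ≡ lft → Edge L r (inner v i) (on v)
    query₀-bnd    : ∀ {i} → r i ≢ lft → Edge L r (query₀ i) (bnd i)
    query₁-bnd    : ∀ {i} → r i ≡ sel → Edge L r (query₁ i) (bnd i)
    query₁-query₀ : ∀ {i} → r i ≢ sel → Edge L r (query₁ i) (query₀ i)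

  _≟ⱽ_ : (u z : V) → Dec (u ≡ z)
  _≟ⱽ_ = via-injection (↔⇒↣ (↔-sym vertex)) Fin._≟_
  open DecMembership _≟ⱽ_ using (_∈?_)

  module _ {L : Fin M → Bool} {r : Fin b → Digit} where

    private
      -- Upper neighbours as a list, which makes `Edge` decidable through list membership.
      up : V → List V
      up (bnd i)      = []
      up hub₀         = []
      up hub₁         = []
      up (token v)    = if L v then hub₀ ∷ hub₁ ∷ [] else []
      up (on v)       = []
      up (pin v)      = on v ∷ []
      up (off v)      = token v ∷ on v ∷ pin v ∷ []
      up (outer v i)  with code v i
      ... | lft = bnd i ∷ []
      ... | rgt = []
      ... | sel = bnd i ∷ off v ∷ []
      up (middle v i) with code v i
      ... | sel = []
      ... | _   = outer v i ∷ []
      up (inner v i)  with code v i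
      ... | lft = middle v i ∷ on v ∷ []
      ... | _   = middle v i ∷ []
      up (query₀ i)   with r i
      ... | lft = []
      ... | _   = bnd i ∷ []
      up (query₁ i)   with r i
      ... | sel = bnd i ∷ []
      ... | _   = query₀ i ∷ []

      up⇒Edge : ∀ u {z} → z ∈ˡ up u → Edge L r u z
      up⇒Edge hub₀         ()
      up⇒Edge hub₁         ()
      up⇒Edge (token v)    m with L v in eq
      up⇒Edge (token v)    (here refl)         | true = token-hub₀ eq
      up⇒Edge (token v)    (there (here refl)) | true = token-hub₁ eq
      up⇒Edge (pin v)      (here refl)                 = pin-on
      up⇒Edge (off v)      (here refl)                 = off-token
      up⇒Edge (off v)      (there (here refl))         = off-on
      up⇒Edge (off v)      (there (there (here refl))) = off-pin
      up⇒Edge (outer v i)  m with code v i in eq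
      up⇒Edge (outer v i)  (here refl)         | lft =
        outer-bnd λ e → contradiction (trans (sym eq) e) λ ()
      up⇒Edge (outer v i)  (here refl)         | sel =
        outer-bnd λ e → contradiction (trans (sym eq) e) λ ()
      up⇒Edge (outer v i)  (there (here refl)) | sel = outer-off eq
      up⇒Edge (middle v i) m with code v i in eq
      up⇒Edge (middle v i) (here refl)         | lft =
        middle-outer λ e → contradiction (trans (sym eq) e) λ ()
      up⇒Edge (middle v i) (here refl)         | rgt =
        middle-outer λ e → contradiction (trans (sym eq) e) λ ()
      up⇒Edge (middle v i) ()                  | sel
      up⇒Edge (inner v i)  m with code v i in eq
      up⇒Edge (inner v i)  (here refl)         | lft = inner-middle
      up⇒Edge (inner v i)  (there (here refl)) | lft = inner-on eq
      up⇒Edge (inner v i)  (here refl)         | rgt = inner-middle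
      up⇒Edge (inner v i)  (here refl)         | sel = inner-middle
      up⇒Edge (query₀ i)   m with r i in eq
      up⇒Edge (query₀ i)   (here refl)         | rgt =
        query₀-bnd λ e → contradiction (trans (sym eq) e) λ ()
      up⇒Edge (query₀ i)   (here refl)         | sel =
        query₀-bnd λ e → contradiction (trans (sym eq) e) λ ()
      up⇒Edge (query₁ i)   m with r i in eq
      up⇒Edge (query₁ i)   (here refl)         | lft =
        query₁-query₀ λ e → contradiction (trans (sym eq) e) λ ()
      up⇒Edge (query₁ i)   (here refl)         | rgt =
        query₁-query₀ λ e → contradiction (trans (sym eq) e) λ ()
      up⇒Edge (query₁ i)   (here refl)         | sel = query₁-bnd eq

      Edge⇒up : ∀ {u z} → Edge L r u z → z ∈ˡ up u
      Edge⇒up (token-hub₀ e) rewrite e = here refl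
      Edge⇒up (token-hub₁ e) rewrite e = there (here refl)
      Edge⇒up pin-on    = here refl
      Edge⇒up off-token = here refl
      Edge⇒up off-on    = there (here refl)
      Edge⇒up off-pin   = there (there (here refl))
      Edge⇒up (outer-bnd {v} {i} e) with code v i
      ... | lft = here refl
      ... | rgt = contradiction refl e
      ... | sel = here refl
      Edge⇒up (outer-off e) rewrite e = there (here refl)
      Edge⇒up (middle-outer {v} {i} e) with code v i
      ... | lft = here refl
      ... | rgt = here refl
      ... | sel = contradiction refl e
      Edge⇒up (inner-middle {v} {i}) with code v i
      ... | lft = here refl
      ... | rgt = here refl
      ... | sel = here refl
      Edge⇒up (inner-on e) rewrite e = there (here refl)
      Edge⇒up (query₀-bnd {i} e) with r i
      ... | lft = contradiction refl e
      ... | rgt = here refl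
      ... | sel = here refl
      Edge⇒up (query₁-bnd e) rewrite e = here refl
      Edge⇒up (query₁-query₀ {i} e) with r i
      ... | lft = here refl
      ... | rgt = here refl
      ... | sel = contradiction refl e

    edge? : ∀ u z → Dec (Edge L r u z)
    edge? u z = map′ (up⇒Edge u) Edge⇒up (z ∈? up u)

  module _ (L : Fin M → Bool) (r : Fin b → Digit) where

    Nbr : V → V → Set
    Nbr u z = Edge L r u z ⊎ Edge L r z u

    Dominated : (V → Set) → V → Set
    Dominated In u = In u ⊎ ∃ λ z → In z × Nbr u z

    -- The vertices `hub₀`, `pin v`, `middle v i` and `query₁ i` have their closed neighbourhoods
    -- inside their own cells, so dominating them puts a selected vertex into each cell.
    meets-cells : (In : V → Set) → (∀ u → Dominated In u) → ∀ c → ∃ λ u → In u × cell u ≡ c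
    meets-cells In dominated hubCell with dominated hub₀
    ... | inj₁ s                           = _ , s , refl
    ... | inj₂ (_ , s , inj₂ (token-hub₀ _)) = _ , s , refl
    meets-cells In dominated (switchCell v) with dominated (pin v)
    ... | inj₁ s                       = _ , s , refl
    ... | inj₂ (_ , s , inj₁ pin-on)   = _ , s , refl
    ... | inj₂ (_ , s , inj₂ off-pin)  = _ , s , refl
    meets-cells In dominated (wireCell v i) with dominated (middle v i)
    ... | inj₁ s                                = _ , s , refl
    ... | inj₂ (_ , s , inj₁ (middle-outer _))  = _ , s , refl
    ... | inj₂ (_ , s , inj₂ inner-middle)      = _ , s , refl
    meets-cells In dominated (queryCell i) with dominated (query₁ i)
    ... | inj₁ s                                 = _ , s , refl
    ... | inj₂ (_ , s , inj₁ (query₁-bnd _))     = _ , s , refl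
    ... | inj₂ (_ , s , inj₁ (query₁-query₀ _))  = _ , s , refl

    module _ (In : V → Set) (dominated : ∀ u → Dominated In u)
             (one : ∀ {u z} → In u → In z → cell u ≡ cell z → u ≡ z) where

      private
        apart : ∀ {u z} {A : Set} → In u → In z → cell u ≡ cell z → u ≢ z → A
        apart s t e ne = contradiction (one s t e) ne

        -- The hubs share a cell and are not adjacent, so they cannot both be selected to dominate
        -- themselves. One of them relies on a token, and tokens see the hubs only where `L` holds.
        chosen-token : ∃ λ u → In (token u) × L u ≡ true
        chosen-token with dominated hub₀ | dominated hub₁
        ... | inj₂ (_ , s , inj₂ (token-hub₀ l)) | _ = _ , s , l
        ... | inj₁ _ | inj₂ (_ , s , inj₂ (token-hub₁ l)) = _ , s , l
        ... | inj₁ s | inj₁ t = apart s t refl λ ()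

        -- With `on v` selected, `off v` is not. If `token v` relied on a hub, the other hub would
        -- need a second selected vertex of the hub cell.
        on⇒token : ∀ {v} → In (on v) → In (token v)
        on⇒token {v} s with dominated (token v)
        ... | inj₁ t = t
        ... | inj₂ (_ , t , inj₂ off-token) = apart s t refl λ ()
        ... | inj₂ (_ , t , inj₁ (token-hub₀ l)) with dominated hub₁
        ...   | inj₁ t′ = apart t t′ refl λ ()
        ...   | inj₂ (_ , t′ , inj₂ (token-hub₁ _)) = apart t t′ refl λ ()
        on⇒token {v} s | inj₂ (_ , t , inj₁ (token-hub₁ l)) with dominated hub₀
        ...   | inj₁ t′ = apart t t′ refl λ ()
        ...   | inj₂ (_ , t′ , inj₂ (token-hub₀ _)) = apart t t′ refl λ ()

        -- Unless `r i` is `sel`, the only neighbour of `query₁ i` is `query₀ i`; one of these two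
        -- takes the single place in the cell they share with `bnd i`.
        unselected : ∀ {i} → r i ≢ sel → ¬ In (bnd i)
        unselected {i} ne s with dominated (query₁ i)
        ... | inj₁ t = apart s t refl λ ()
        ... | inj₂ (_ , _ , inj₁ (query₁-bnd e)) = ne e
        ... | inj₂ (_ , t , inj₁ (query₁-query₀ _)) = apart s t refl λ ()

        -- Now `inner v i` cannot be dominated from within its wire; only `on v` is left, and it is
        -- adjacent only for the digit `lft`.
        outer⇒lft×on : ∀ {v i} → code v i ≢ rgt → In (outer v i) → code v i ≡ lft × In (on v)
        outer⇒lft×on {v} {i} ne s with dominated (inner v i) | dominated (middle v i) | code v i in eq
        ... | _ | _ | rgt = contradiction refl ne
        ... | inj₁ t                             | _ | _ = apart s t refl λ ()
        ... | inj₂ (_ , t , inj₁ inner-middle)   | _ | _ = apart s t refl λ ()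
        ... | inj₂ (_ , t , inj₁ (inner-on _))   | _ | lft = refl , t
        ... | inj₂ (_ , t , inj₁ (inner-on e))   | _ | sel = contradiction (trans (sym eq) e) λ ()

        -- For `lft` the query side neither selects nor dominates `bnd i`, so the outer end of some
        -- wire has to.
        lft⇒on : ∀ {i} → r i ≡ lft → ∃ λ v → code v i ≡ lft × In (on v)
        lft⇒on {i} e with dominated (bnd i)
        ... | inj₁ s = contradiction s (unselected λ e′ → contradiction (trans (sym e) e′) λ ())
        ... | inj₂ (_ , _ , inj₂ (query₀-bnd ne)) = contradiction e ne
        ... | inj₂ (_ , _ , inj₂ (query₁-bnd e′)) = contradiction (trans (sym e) e′) λ ()
        ... | inj₂ (_ , s , inj₂ (outer-bnd ne)) = _ , outer⇒lft×on ne s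

        token-unique : ∀ {u v} → In (token u) → In (token v) → u ≡ v
        token-unique s t with refl ← one s t refl = refl

        -- For the digit `sel`, `outer v i` may not be selected and is cut off from `middle v i`;
        -- with `off v` excluded by `on v`, only `bnd i` can dominate it.
        sel⇒bnd : ∀ {v i} → code v i ≡ sel → In (on v) → In (bnd i)
        sel⇒bnd {v} {i} e s with dominated (outer v i)
        ... | inj₁ t =
          contradiction (trans (sym e) (proj₁ (outer⇒lft×on (λ e′ → contradiction (trans (sym e) e′) λ ()) t))) λ ()
        ... | inj₂ (_ , t , inj₁ (outer-bnd _)) = t
        ... | inj₂ (_ , t , inj₁ (outer-off _)) = apart s t refl λ ()
        ... | inj₂ (_ , t , inj₂ (middle-outer ne)) = contradiction e ne

      -- The `lft` at `i₀` forces some gadget on, and uniqueness of the token makes it the one of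
      -- `u`. Where `r i` is `lft`, the wire that dominates `bnd i` again belongs to `u`; where it
      -- is `rgt`, a digit `sel` of `u` would need `bnd i` to be selected.
      below-query : ∀ {i₀} → r i₀ ≡ lft → ∃ λ u → L u ≡ true × ∀ i → code u i Fin.≤ r i
      below-query {i₀} e₀ with chosen-token | lft⇒on e₀
      ... | u , s , l | w , _ , t with refl ← token-unique s (on⇒token t) = u , l , bound
        where
        bound : ∀ i → code u i Fin.≤ r i
        bound i with r i in eq
        ... | sel = ℕ.s≤s⁻¹ (Fin.toℕ<n (code u i))
        ... | lft with v , e , t′ ← lft⇒on eq
                  with refl ← token-unique s (on⇒token t′) = ℕ.≤-reflexive (cong toℕ e)
        bound i | rgt with code u i in e
        ... | lft = z≤n
        ... | rgt = ℕ.≤-refl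
        ... | sel =
          contradiction (sel⇒bnd e t) (unselected λ e′ → contradiction (trans (sym eq) e′) λ ())

    module _ (v₀ : Fin M) (l : L v₀ ≡ true) (reads : ∀ i → r i ≡ code v₀ i) where

      choice : Cell → V
      choice hubCell = token v₀
      choice (switchCell v) with v Fin.≟ v₀
      ... | yes _ = on v
      ... | no  _ = off v
      choice (wireCell v i) with v Fin.≟ v₀ | code v i
      ... | yes _ | lft = outer v i
      ... | _     | _   = middle v i
      choice (queryCell i) with r i
      ... | sel = bnd i
      ... | _   = query₀ i

      private
        Chosen : V → Set
        Chosen z = ∃ λ c → z ≡ choice c

        token∈ : Chosen (token v₀)
        token∈ = hubCell , refl

        on∈ : Chosen (on v₀)
        on∈ = switchCell v₀ , eq
          where
          eq : on v₀ ≡ choice (switchCell v₀)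
          eq with v₀ Fin.≟ v₀
          ... | yes _ = refl
          ... | no  n = contradiction refl n

        off∈ : ∀ {v} → v ≢ v₀ → Chosen (off v)
        off∈ {v} ne = switchCell v , eq
          where
          eq : off v ≡ choice (switchCell v)
          eq with v Fin.≟ v₀
          ... | yes e = contradiction e ne
          ... | no  _ = refl

        outer∈ : ∀ {i} → code v₀ i ≡ lft → Chosen (outer v₀ i)
        outer∈ {i} e = wireCell v₀ i , eq
          where
          eq : outer v₀ i ≡ choice (wireCell v₀ i)
          eq with v₀ Fin.≟ v₀ | code v₀ i
          ... | yes _ | lft = refl
          ... | yes _ | suc _ = contradiction e λ ()
          ... | no  n | _   = contradiction refl n

        middle∈ : ∀ {v i} → v ≢ v₀ ⊎ code v i ≢ lft → Chosen (middle v i)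
        middle∈ {v} {i} ne = wireCell v i , eq ne
          where
          eq : v ≢ v₀ ⊎ code v i ≢ lft → middle v i ≡ choice (wireCell v i)
          eq ne with v Fin.≟ v₀ | code v i
          eq (inj₁ n) | yes e | lft = contradiction e n
          eq (inj₂ n) | yes _ | lft = contradiction refl n
          eq _ | yes _ | rgt = refl
          eq _ | yes _ | sel = refl
          eq _ | no _  | _   = refl

        bnd∈ : ∀ {i} → r i ≡ sel → Chosen (bnd i)
        bnd∈ {i} e = queryCell i , eq
          where
          eq : bnd i ≡ choice (queryCell i)
          eq rewrite e = refl

        query∈ : ∀ {i} → r i ≢ sel → Chosen (query₀ i)
        query∈ {i} ne = queryCell i , eq
          where
          eq : query₀ i ≡ choice (queryCell i)
          eq with r i
          ... | lft = refl
          ... | rgt = refl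
          ... | sel = contradiction refl ne

        differ : ∀ {x d e : Digit} → x ≡ d → d ≢ e → x ≢ e
        differ refl ne = ne

      -- A gadget that is off is dominated by its `off v` and its middle vertices. In the gadget of
      -- `v₀`, wires reading `lft` select their outer ends and leave the inner ones to `on v₀`.
      -- Wires reading `sel` rely on boundary vertices, which are selected because the query is the
      -- codeword of `v₀`.
      choice-dominates : ∀ u → Dominated (λ z → ∃ λ c → z ≡ choice c) u
      choice-dominates hub₀ = inj₂ (_ , token∈ , inj₂ (token-hub₀ l))
      choice-dominates hub₁ = inj₂ (_ , token∈ , inj₂ (token-hub₁ l))
      choice-dominates (token v) with v Fin.≟ v₀
      ... | yes refl = inj₁ token∈
      ... | no  ne   = inj₂ (_ , off∈ ne , inj₂ off-token)
      choice-dominates (on v) with v Fin.≟ v₀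
      ... | yes refl = inj₁ on∈
      ... | no  ne   = inj₂ (_ , off∈ ne , inj₂ off-on)
      choice-dominates (pin v) with v Fin.≟ v₀
      ... | yes refl = inj₂ (_ , on∈ , inj₁ pin-on)
      ... | no  ne   = inj₂ (_ , off∈ ne , inj₂ off-pin)
      choice-dominates (off v) with v Fin.≟ v₀
      ... | yes refl = inj₂ (_ , on∈ , inj₁ off-on)
      ... | no  ne   = inj₁ (off∈ ne)
      choice-dominates (outer v i) with v Fin.≟ v₀ | code v i in e
      ... | yes refl | lft = inj₁ (outer∈ e)
      ... | no  ne   | lft = inj₂ (_ , middle∈ (inj₁ ne) , inj₂ (middle-outer (differ e λ ())))
      ... | _        | rgt =
        inj₂ (_ , middle∈ (inj₂ (differ e λ ())) , inj₂ (middle-outer (differ e λ ())))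
      ... | yes refl | sel = inj₂ (_ , bnd∈ (trans (reads i) e) , inj₁ (outer-bnd (differ e λ ())))
      ... | no  ne   | sel = inj₂ (_ , off∈ ne , inj₁ (outer-off e))
      choice-dominates (middle v i) with v Fin.≟ v₀ | code v i in e
      ... | yes refl | lft = inj₂ (_ , outer∈ e , inj₁ (middle-outer (differ e λ ())))
      ... | no  ne   | lft = inj₁ (middle∈ (inj₁ ne))
      ... | _        | rgt = inj₁ (middle∈ (inj₂ (differ e λ ())))
      ... | _        | sel = inj₁ (middle∈ (inj₂ (differ e λ ())))
      choice-dominates (inner v i) with v Fin.≟ v₀ | code v i in e
      ... | yes refl | lft = inj₂ (_ , on∈ , inj₁ (inner-on e))
      ... | no  ne   | lft = inj₂ (_ , middle∈ (inj₁ ne) , inj₁ inner-middle)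
      ... | _        | rgt = inj₂ (_ , middle∈ (inj₂ (differ e λ ())) , inj₁ inner-middle)
      ... | _        | sel = inj₂ (_ , middle∈ (inj₂ (differ e λ ())) , inj₁ inner-middle)
      choice-dominates (bnd i) with r i in e
      ... | lft = inj₂ (_ , outer∈ c , inj₂ (outer-bnd (differ c λ ())))
        where
        c : code v₀ i ≡ lft
        c = trans (sym (reads i)) e
      ... | rgt = inj₂ (_ , query∈ (differ e λ ()) , inj₂ (query₀-bnd (differ e λ ())))
      ... | sel = inj₁ (bnd∈ e)
      choice-dominates (query₀ i) with r i in e
      ... | lft = inj₁ (query∈ (differ e λ ()))
      ... | rgt = inj₁ (query∈ (differ e λ ()))
      ... | sel = inj₂ (_ , bnd∈ e , inj₁ (query₀-bnd (differ e λ ())))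
      choice-dominates (query₁ i) with r i in e
      ... | lft = inj₂ (_ , query∈ (differ e λ ()) , inj₁ (query₁-query₀ (differ e λ ())))
      ... | rgt = inj₂ (_ , query∈ (differ e λ ()) , inj₁ (query₁-query₀ (differ e λ ())))
      ... | sel = inj₂ (_ , bnd∈ e , inj₁ (query₁-bnd e))

  edge-irrefl : ∀ {L r u} → ¬ Edge L r u u
  edge-irrefl ()

  open Inverse

  ⟦_⟧ : V → Fin order
  ⟦_⟧ = from vertex

  ⟦⟧-from : ∀ x → ⟦ to vertex x ⟧ ≡ x
  ⟦⟧-from = strictlyInverseʳ vertex

  to-⟦⟧ : ∀ u → to vertex ⟦ u ⟧ ≡ u
  to-⟦⟧ = strictlyInverseˡ vertex

  nbr? : ∀ L r u z → Dec (Nbr L r u z)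
  nbr? L r u z = edge? u z ⊎-dec edge? z u

  gadgetGraph : (Fin M → Bool) → (Fin b → Digit) → Graph order
  gadgetGraph L r = record
    { adj        = λ x y → does (nbr? L r (to vertex x) (to vertex y))
    ; adj-sym    = λ x y → Bool.∨-comm (does (edge? (to vertex x) (to vertex y))) _
    ; adj-irrefl = λ x → dec-false (nbr? L r (to vertex x) (to vertex x)) [ edge-irrefl , edge-irrefl ]′
    }

  module _ {L : Fin M → Bool} {r : Fin b → Digit} where

    adj⇒Nbr : ∀ {x y} → Adj (gadgetGraph L r) x y → Nbr L r (to vertex x) (to vertex y)
    adj⇒Nbr {x} {y} = does⇒ (nbr? L r (to vertex x) (to vertex y))

    Nbr⇒adj : ∀ {x y} → Nbr L r (to vertex x) (to vertex y) → Adj (gadgetGraph L r) x y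
    Nbr⇒adj {x} {y} e = dec-true (nbr? L r (to vertex x) (to vertex y)) e

    -- The budget equals the number of cells and every cell is met, so `one-per-cell` reduces the
    -- claim to the constraint problem.
    dominatingSet⇒ : DominatingSet (gadgetGraph L r) (+ cells) → ∀ {i₀} → r i₀ ≡ lft →
      ∃ λ u → L u ≡ true × ∀ i → code u i Fin.≤ r i
    dominatingSet⇒ (S , small , dom) = below-query L r In dominated one
      where
      In : V → Set
      In u = ⟦ u ⟧ ∈ S

      dominated : ∀ u → Dominated L r In u
      dominated u with dom ⟦ u ⟧
      ... | inj₁ s = inj₁ s
      ... | inj₂ (y , s , a) =
        inj₂ (to vertex y , subst (_∈ S) (sym (⟦⟧-from y)) s
             , subst (λ u → Nbr L r u (to vertex y)) (to-⟦⟧ u) (adj⇒Nbr a))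

      cellOf : Fin order → Fin cells
      cellOf = from cellIndex ∘ cell ∘ to vertex

      cellOf-⟦⟧ : ∀ u → cellOf ⟦ u ⟧ ≡ from cellIndex (cell u)
      cellOf-⟦⟧ u = cong (from cellIndex ∘ cell) (to-⟦⟧ u)

      one : ∀ {u z} → In u → In z → cell u ≡ cell z → u ≡ z
      one {u} {z} s t e =
        trans (sym (to-⟦⟧ u)) (trans (cong (to vertex) same) (to-⟦⟧ z))
        where
        meets : ∀ c → ∃ λ x → x ∈ S × cellOf x ≡ c
        meets c with u , s , e ← meets-cells L r In dominated (to cellIndex c) =
          ⟦ u ⟧ , s , trans (cellOf-⟦⟧ u) (trans (cong (from cellIndex) e) (strictlyInverseʳ cellIndex c))

        same : ⟦ u ⟧ ≡ ⟦ z ⟧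
        same = one-per-cell cellOf S (ℤ.drop‿+≤+ small) meets s t
          (trans (cellOf-⟦⟧ u) (trans (cong (from cellIndex) e) (sym (cellOf-⟦⟧ z))))

    ⇒dominatingSet : ∀ v₀ → L v₀ ≡ true → (∀ i → r i ≡ code v₀ i) →
      DominatingSet (gadgetGraph L r) (+ cells)
    ⇒dominatingSet v₀ l reads = image f , ℤ.+≤+ (∣image∣≤ f) , dominated
      where
      f : Fin cells → Fin order
      f c = ⟦ choice L r v₀ l reads (to cellIndex c) ⟧

      chosen : ∀ {z} → (∃ λ c → z ≡ choice L r v₀ l reads c) → ⟦ z ⟧ ∈ image f
      chosen (c , refl) =
        subst (λ c → ⟦ choice L r v₀ l reads c ⟧ ∈ image f) (strictlyInverseˡ cellIndex c)
          (∈-image f (from cellIndex c))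

      dominated : ∀ x → x ∈ image f ⊎ ∃ λ y → y ∈ image f × Adj (gadgetGraph L r) x y
      dominated x with choice-dominates L r v₀ l reads (to vertex x)
      ... | inj₁ s = inj₁ (subst (_∈ image f) (⟦⟧-from x) (chosen s))
      ... | inj₂ (z , s , e) =
        inj₂ (⟦ z ⟧ , chosen s , Nbr⇒adj (subst (Nbr L r (to vertex x)) (sym (to-⟦⟧ z)) e))

-- Unique lists

unique-++⁻ : ∀ {A : Set} (xs : List A) {ys} → Unique (xs ++ ys) →
  Unique xs × Unique ys × (∀ {x} → x ∈ˡ xs → x ∉ˡ ys)
unique-++⁻ []       u       = [] , u , λ ()
unique-++⁻ (x ∷ xs) (p ∷ u) with uˣ , uʸ , disjoint ← unique-++⁻ xs u =
  All.++⁻ˡ xs p ∷ uˣ , uʸ , λ where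
    (here refl) m → All.lookup (All.++⁻ʳ xs p) m refl
    (there l)   m → disjoint l m

unique-middle⁻ : ∀ {A : Set} (xs : List A) {a ys} → Unique (xs ++ a ∷ ys) →
  Unique xs × Unique ys × a ∉ˡ xs × a ∉ˡ ys × (∀ {x} → x ∈ˡ xs → x ∉ˡ ys)
unique-middle⁻ xs u with uˣ , a≢ ∷ uʸ , disjoint ← unique-++⁻ xs u =
  uˣ , uʸ , (λ m → disjoint m (here refl)) , (λ m → All.lookup a≢ m refl) , λ l m → disjoint l (there m)

lookup-injective⇒unique : ∀ {A : Set} (xs : List A) →
  (∀ {i j} → lookup xs i ≡ lookup xs j → i ≡ j) → Unique xs
lookup-injective⇒unique []       inj = []
lookup-injective⇒unique (x ∷ xs) inj =
  All.tabulate (λ m e → contradiction (inj {zero} {suc (index m)} (trans e (lookup-index m))) λ ())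
    ∷ lookup-injective⇒unique xs (Fin.suc-injective ∘ inj)

-- Choosing one position per element is injective into at most `n` positions, hence hits every
-- position. This replaces a direct proof that the labels of the forest are distinct.
complete⇒unique : ∀ {n} (xs : List (Fin n)) → length xs ≤ n → (∀ v → v ∈ˡ xs) → Unique xs
complete⇒unique {n} xs short complete = lookup-injective⇒unique xs inj
  where
  at : Fin n → Fin (length xs)
  at v = index (complete v)

  at-injective : ∀ {u v} → at u ≡ at v → u ≡ v
  at-injective {u} {v} e =
    trans (lookup-index (complete u)) (trans (cong (lookup xs) e) (sym (lookup-index (complete v))))

  at-surjective : ∀ i → ∃ λ v → at v ≡ i
  at-surjective i with Fin.any? (λ v → at v Fin.≟ i)
  ... | yes found = found
  ... | no missing = contradiction
    (Fin.injective⇒≤ {f = extended} extended-injective) (ℕ.<⇒≱ (s≤s short))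
    where
    extended : Fin (suc n) → Fin (length xs)
    extended zero    = i
    extended (suc v) = at v

    extended-injective : ∀ {u v} → extended u ≡ extended v → u ≡ v
    extended-injective {zero}  {zero}  _ = refl
    extended-injective {zero}  {suc v} e = contradiction (v , sym e) missing
    extended-injective {suc u} {zero}  e = contradiction (u , e) missing
    extended-injective {suc u} {suc v} e = cong suc (at-injective e)

  inj : ∀ {i j} → lookup xs i ≡ lookup xs j → i ≡ j
  inj {i} {j} e with u , refl ← at-surjective i | v , refl ← at-surjective j =
    cong at (trans (lookup-index (complete u)) (trans e (sym (lookup-index (complete v)))))

-- Nodes of forests

label∈postorder : ∀ {A : Set} {F : Forest A} (x : Node F) → label x ∈ˡ postorder F
label∈postorder (root {F = node a G ∷ F} (here refl))    = ∈-++⁺ʳ (postorder G) (here refl)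
label∈postorder (root {F = node a G ∷ F} (there i))      =
  ∈-++⁺ʳ (postorder G) (there (label∈postorder (root i)))
label∈postorder (below {F = node a G ∷ F} (here refl) x) = ∈-++⁺ˡ (label∈postorder x)
label∈postorder (below {F = node a G ∷ F} (there i) x)   =
  ∈-++⁺ʳ (postorder G) (there (label∈postorder (below i x)))

later : ∀ {A : Set} {t : Tree A} {F : Forest A} → Node F → Node (t ∷ F)
later (root i)    = root (there i)
later (below i x) = below (there i) x

label-later : ∀ {A : Set} {t : Tree A} {F : Forest A} (x : Node F) → label (later {t = t} x) ≡ label x
label-later (root i)    = refl
label-later (below i x) = refl

postorder∋ : ∀ {A : Set} (F : Forest A) {a} → a ∈ˡ postorder F → ∃ λ (x : Node F) → label x ≡ a
postorder∋ (node b G ∷ F) m with ∈-++⁻ (postorder G) m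
... | inj₁ l with x , e ← postorder∋ G l = below (here refl) x , e
... | inj₂ (here refl) = root (here refl) , refl
... | inj₂ (there l) with x , e ← postorder∋ F l = later x , trans (label-later x) e

private
  data View {A : Set} {a : A} {G F : Forest A} : Node (node a G ∷ F) → Set where
    atRoot : View (root (here refl))
    inside : (x : Node G) → View (below (here refl) x)
    after  : (x : Node F) → View (later x)

  view : ∀ {A : Set} {a : A} {G F : Forest A} (x : Node (node a G ∷ F)) → View x
  view (root (here refl))    = atRoot
  view (root (there i))      = after (root i)
  view (below (here refl) x) = inside x
  view (below (there i) x)   = after (below i x)

  later∈ : ∀ {A : Set} {t : Tree A} {F : Forest A} {a} (x : Node F) → label (later {t = t} x) ≡ a →
    a ∈ˡ postorder F
  later∈ {F = F} x e = subst (_∈ˡ postorder F) (trans (sym (label-later x)) e) (label∈postorder x)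

label-injective : ∀ {A : Set} (F : Forest A) → Unique (postorder F) →
  (x y : Node F) → label x ≡ label y → x ≡ y
label-injective [] u (root ())
label-injective [] u (below () _)
label-injective (node a G ∷ F) u x y e
  with uᴳ , uᶠ , a∉G , a∉F , disjoint ← unique-middle⁻ (postorder G) u
  with view x | view y
... | atRoot    | atRoot    = refl
... | atRoot    | inside y = contradiction (subst (_∈ˡ postorder G) (sym e) (label∈postorder y)) a∉G
... | atRoot    | after y  = contradiction (later∈ y (sym e)) a∉F
... | inside x | atRoot    = contradiction (subst (_∈ˡ postorder G) e (label∈postorder x)) a∉G
... | inside x | inside y = cong (below (here refl)) (label-injective G uᴳ x y e)
... | inside x | after y  = contradiction (later∈ y (sym e)) (disjoint (label∈postorder x))
... | after x  | atRoot    = contradiction (later∈ x e) a∉F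
... | after x  | inside y = contradiction (later∈ x e) (disjoint (label∈postorder y))
... | after x  | after y  = cong later (label-injective F uᶠ x y
  (trans (sym (label-later x)) (trans e (label-later y))))

root-ancestor : ∀ {A : Set} {a : A} {F G : Forest A} (i : node a G ∈ˡ F) (x : Node G) →
  Ancestor (root i) (below i x)
root-ancestor i (root j)    = top ◅ Star.ε
root-ancestor i (below j x) = top ◅ Star.gmap (below i) down (root-ancestor j x)

-- Sets of ancestors

bagsOf : ∀ {n} → Subset n → Forest (Fin n) → List (Subset n)
bagsOf A F = postorder (rootPaths A F)

bag : ∀ {n} {F : Forest (Fin n)} → Subset n → Node F → Subset n
bag A (root {t} _)    = A ∪ ⁅ rootLabel t ⁆
bag A (below {a} _ x) = bag (A ∪ ⁅ a ⁆) x

bag∈bagsOf : ∀ {n} {F : Forest (Fin n)} A (x : Node F) → bag A x ∈ˡ bagsOf A F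
bag∈bagsOf A (root {F = node a G ∷ F} (here refl))    = ∈-++⁺ʳ (bagsOf _ G) (here refl)
bag∈bagsOf A (root {F = node a G ∷ F} (there i))      =
  ∈-++⁺ʳ (bagsOf _ G) (there (bag∈bagsOf A (root i)))
bag∈bagsOf A (below {F = node a G ∷ F} (here refl) x) = ∈-++⁺ˡ (bag∈bagsOf _ x)
bag∈bagsOf A (below {F = node a G ∷ F} (there i) x)   =
  ∈-++⁺ʳ (bagsOf _ G) (there (bag∈bagsOf A (below i x)))

label∈bag : ∀ {n} {F : Forest (Fin n)} A (x : Node F) → label x ∈ bag A x
label∈bag A (root {t} _) = x∈p∪q⁺ (inj₂ (x∈⁅x⁆ (rootLabel t)))
label∈bag A (below _ x)  = label∈bag _ x

parent-bag : ∀ {n} {F : Forest (Fin n)} A {x y : Node F} → Parent x y → bag A x ⊆ bag A y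
parent-bag A (top {j = j}) = x∈p∪q⁺ ∘ inj₁
parent-bag A (down p)      = parent-bag _ p

ancestor-bag : ∀ {n} {F : Forest (Fin n)} A {x y : Node F} → Ancestor x y → bag A x ⊆ bag A y
ancestor-bag A Star.ε       m = m
ancestor-bag A (p ◅ s) m = ancestor-bag A s (parent-bag A p m)

length-bagsOf : ∀ {n} A (F : Forest (Fin n)) → length (bagsOf A F) ≡ length (postorder F)
length-bagsOf A []             = refl
length-bagsOf A (node a G ∷ F) = begin
  length (bagsOf A′ G ++ A′ ∷ bagsOf A F)           ≡⟨ length-++ (bagsOf A′ G) ⟩
  length (bagsOf A′ G) + suc (length (bagsOf A F))
    ≡⟨ cong₂ (λ x y → x + suc y) (length-bagsOf A′ G) (length-bagsOf A F) ⟩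
  length (postorder G) + suc (length (postorder F)) ≡⟨ length-++ (postorder G) ⟨
  length (postorder G ++ a ∷ postorder F)           ∎
  where
  open ≡-Reasoning
  A′ = A ∪ ⁅ a ⁆

bagsOf-within : ∀ {n} (Q : Fin n → Set) A (F : Forest (Fin n)) → (∀ {v} → v ∈ A → Q v) →
  All Q (postorder F) → All (λ X → ∀ {v} → v ∈ X → Q v) (bagsOf A F)
bagsOf-within Q A []             q qs = []
bagsOf-within Q A (node a G ∷ F) q qs with q′ ∷ qs′ ← All.++⁻ʳ (postorder G) qs =
  All.++⁺ (bagsOf-within Q _ G q⁺ (All.++⁻ˡ (postorder G) qs)) (q⁺ ∷ bagsOf-within Q A F q qs′)
  where
  q⁺ : ∀ {v} → v ∈ A ∪ ⁅ a ⁆ → Q v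
  q⁺ m with x∈p∪q⁻ A ⁅ a ⁆ m
  ... | inj₁ l = q l
  ... | inj₂ l with refl ← x∈⁅y⁆⇒x≡y a l = q′

∣p∪⁅x⁆∣≡1+∣p∣ : ∀ {n} (p : Subset n) x → x ∉ p → ∣ p ∪ ⁅ x ⁆ ∣ ≡ suc ∣ p ∣
∣p∪⁅x⁆∣≡1+∣p∣ (false ∷ p) zero    _ = cong (suc ∘ ∣_∣) (∪-identityʳ p)
∣p∪⁅x⁆∣≡1+∣p∣ (true ∷ p)  zero    n = contradiction Vec.here n
∣p∪⁅x⁆∣≡1+∣p∣ (false ∷ p) (suc x) n = ∣p∪⁅x⁆∣≡1+∣p∣ p x (n ∘ Vec.there)
∣p∪⁅x⁆∣≡1+∣p∣ (true ∷ p)  (suc x) n = cong suc (∣p∪⁅x⁆∣≡1+∣p∣ p x (n ∘ Vec.there))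

∉-extend : ∀ {n} {A : Subset n} {a v} → v ∉ A → v ≢ a → v ∉ A ∪ ⁅ a ⁆
∉-extend {A = A} {a} v∉A v≢a m = [ v∉A , v≢a ∘ x∈⁅y⁆⇒x≡y a ]′ (x∈p∪q⁻ A ⁅ a ⁆ m)

largest : ∀ {n} → List (Subset n) → ℕ
largest Xs = foldr _⊔_ 0 (map ∣_∣ Xs)

largest-++ : ∀ {n} (Xs Ys : List (Subset n)) → largest (Xs ++ Ys) ≡ largest Xs ⊔ largest Ys
largest-++ []       Ys = refl
largest-++ (X ∷ Xs) Ys =
  trans (cong (∣ X ∣ ⊔_) (largest-++ Xs Ys)) (sym (ℕ.⊔-assoc ∣ X ∣ (largest Xs) (largest Ys)))

-- The term `∣ A ∣` covers the empty forest, which has no bags. Distinct labels outside `A` make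
-- each level add exactly one element.
∣A∣⊔largest : ∀ {n} A (F : Forest (Fin n)) → Unique (postorder F) → All (_∉ A) (postorder F) →
  ∣ A ∣ ⊔ largest (bagsOf A F) ≡ ∣ A ∣ + height F
∣A∣⊔largest A []             _ _ = trans (ℕ.⊔-identityʳ ∣ A ∣) (sym (ℕ.+-identityʳ ∣ A ∣))
∣A∣⊔largest A (node a G ∷ F) u out
  with uᴳ , uᶠ , a∉G , a∉F , _ ← unique-middle⁻ (postorder G) u
  with a∉A ∷ outᶠ ← All.++⁻ʳ (postorder G) out = begin
  p ⊔ largest (bagsOf A′ G ++ A′ ∷ bagsOf A F)
    ≡⟨ cong (p ⊔_) (largest-++ (bagsOf A′ G) (A′ ∷ bagsOf A F)) ⟩
  p ⊔ (g ⊔ (p′ ⊔ f))    ≡⟨ cong (p ⊔_) (ℕ.⊔-assoc g p′ f) ⟨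
  p ⊔ (g ⊔ p′ ⊔ f)      ≡⟨ cong (λ z → p ⊔ (z ⊔ f)) (ℕ.⊔-comm g p′) ⟩
  p ⊔ (p′ ⊔ g ⊔ f)      ≡⟨ cong (λ z → p ⊔ (z ⊔ f)) ihᴳ ⟩
  p ⊔ (p′ + height G ⊔ f) ≡⟨ ℕ.⊔-assoc p (p′ + height G) f ⟨
  p ⊔ (p′ + height G) ⊔ f ≡⟨ cong (_⊔ f) (ℕ.⊔-comm p (p′ + height G)) ⟩
  p′ + height G ⊔ p ⊔ f ≡⟨ ℕ.⊔-assoc (p′ + height G) p f ⟩
  p′ + height G ⊔ (p ⊔ f) 
    ≡⟨ cong₂ (λ x y → x + height G ⊔ y) (∣p∪⁅x⁆∣≡1+∣p∣ A a a∉A) (∣A∣⊔largest A F uᶠ outᶠ) ⟩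
  suc p + height G ⊔ (p + height F) ≡⟨ cong (_⊔ (p + height F)) (ℕ.+-suc p (height G)) ⟨
  p + suc (height G) ⊔ (p + height F) ≡⟨ ℕ.+-distribˡ-⊔ p (suc (height G)) (height F) ⟨
  p + (suc (height G) ⊔ height F) ∎
  where
  open ≡-Reasoning
  A′ = A ∪ ⁅ a ⁆
  p = ∣ A ∣
  p′ = ∣ A′ ∣
  g = largest (bagsOf A′ G)
  f = largest (bagsOf A F)

  ihᴳ : ∣ A′ ∣ ⊔ g ≡ ∣ A′ ∣ + height G
  ihᴳ = ∣A∣⊔largest A′ G uᴳ (All.tabulate λ m →
    ∉-extend (All.lookup (All.++⁻ˡ (postorder G) out) m) λ where refl → a∉G m)

largest-bagsOf : ∀ {n} (F : Forest (Fin n)) → Unique (postorder F) → largest (bagsOf ⊥ F) ≡ height F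
largest-bagsOf {n} F u with e ← ∣A∣⊔largest ⊥ F u (All.tabulate λ _ → ∉⊥) rewrite ∣⊥∣≡0 n = e

-- The path of all sets of ancestors

record Interval {n} (v : Fin n) (Xs : List (Subset n)) : Set where
  constructor interval
  field
    front run back : List (Subset n)
    split   : Xs ≡ front ++ run ++ back
    front∌  : All (v ∉_) front
    run∋    : All (v ∈_) run
    back∌   : All (v ∉_) back

bagsOf∌ : ∀ {n} {v : Fin n} A F → v ∉ A → v ∉ˡ postorder F → All (v ∉_) (bagsOf A F)
bagsOf∌ {v = v} A F v∉A v∉F =
  All.map (λ ne m → ne m refl)
    (bagsOf-within (λ u → u ≢ v) A F (λ m → λ where refl → v∉A m) (All.tabulate λ m → λ where refl → v∉F m))

bagsOf∋ : ∀ {n} {v : Fin n} A F → v ∈ A → All (v ∈_) (bagsOf A F)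
bagsOf∋ A []             m = []
bagsOf∋ A (node a G ∷ F) m = All.++⁺ (bagsOf∋ _ G m⁺) (m⁺ ∷ bagsOf∋ A F m)
  where m⁺ = x∈p∪q⁺ (inj₁ m)

-- The bags containing v are those of the descendants of v.
bagsOf-interval : ∀ {n} {v : Fin n} A F → Unique (postorder F) → v ∉ A → Interval v (bagsOf A F)
bagsOf-interval A []             u v∉A = interval [] [] [] refl [] [] []
bagsOf-interval {v = v} A (node a G ∷ F) u v∉A
  with uᴳ , uᶠ , a∉G , a∉F , disjoint ← unique-middle⁻ (postorder G) u
  with v Fin.≟ a | v ∈? postorder G
  where open DecMembership Fin._≟_ using (_∈?_)
... | yes refl | _ = interval [] (bagsOf A′ G ++ A′ ∷ []) (bagsOf A F)
        (sym (++-assoc (bagsOf A′ G) (A′ ∷ []) _)) []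
        (All.++⁺ (bagsOf∋ A′ G v∈A′) (v∈A′ ∷ [])) (bagsOf∌ A F v∉A a∉F)
  where
  A′ = A ∪ ⁅ a ⁆
  v∈A′ : a ∈ A′
  v∈A′ = x∈p∪q⁺ (inj₂ (x∈⁅x⁆ a))
... | no v≢a | yes v∈G
  with interval bs ds as e b∌ d∋ a∌ ← bagsOf-interval (A ∪ ⁅ a ⁆) G uᴳ (∉-extend v∉A v≢a) =
    interval bs ds (as ++ A′ ∷ bagsOf A F)
      (trans (cong (_++ A′ ∷ bagsOf A F) e)
        (trans (++-assoc bs (ds ++ as) _) (cong (bs ++_) (++-assoc ds as _))))
      b∌ d∋ (All.++⁺ a∌ (∉-extend v∉A v≢a ∷ bagsOf∌ A F v∉A (disjoint v∈G)))
  where A′ = A ∪ ⁅ a ⁆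
... | no v≢a | no v∉G
  with interval bs ds as e b∌ d∋ a∌ ← bagsOf-interval A F uᶠ v∉A =
    interval (bagsOf A′ G ++ A′ ∷ bs) ds as
      (trans (cong (λ Xs → bagsOf A′ G ++ A′ ∷ Xs) e) (sym (++-assoc (bagsOf A′ G) (A′ ∷ bs) _)))
      (All.++⁺ (bagsOf∌ A′ G (∉-extend v∉A v≢a) v∉G) (∉-extend v∉A v≢a ∷ b∌)) d∋ a∌
  where A′ = A ∪ ⁅ a ⁆

-- Each new entry becomes the root, so that the postorder of the path keeps the order of the list.
grow : ∀ {A : Set} → Tree A → List A → Tree A
grow t []       = t
grow t (x ∷ xs) = grow (node x (t ∷ [])) xs

postorder-grow : ∀ {A : Set} (t : Tree A) xs → postorder (grow t xs ∷ []) ≡ postorder (t ∷ []) ++ xs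
postorder-grow (node a F) [] = sym (++-assoc (postorder F) (a ∷ []) [])
postorder-grow t (x ∷ xs)    =
  trans (postorder-grow (node x (t ∷ [])) xs) (++-assoc (postorder (t ∷ [])) (x ∷ []) xs)

isPath-grow : ∀ {A : Set} {t : Tree A} → IsPath t → ∀ xs → IsPath (grow t xs)
isPath-grow p []       = p
isPath-grow p (x ∷ xs) = isPath-grow (step p) xs

private
  data PathView {A : Set} {X : A} {t : Tree A} : Node (node X (t ∷ []) ∷ []) → Set where
    topmost : PathView (root (here refl))
    beneath : (x : Node (t ∷ [])) → PathView (below (here refl) x)

  pathView : ∀ {A : Set} {X : A} {t : Tree A} (x : Node (node X (t ∷ []) ∷ [])) → PathView x
  pathView (root (here refl))    = topmost
  pathView (below (here refl) x) = beneath x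

module _ {n} (v : Fin n) where

  Link : ∀ {t : Tree (Subset n)} → Node (t ∷ []) → Node (t ∷ []) → Set
  Link x y = Parent x y × v ∈ label x × v ∈ label y

  Connected : Tree (Subset n) → Set
  Connected t = ∀ (x y : Node (t ∷ [])) → v ∈ label x → v ∈ label y → EqClosure Link x y

  private
    on-top : ∀ {t X} {x y : Node (t ∷ [])} → EqClosure Link x y →
      EqClosure (Link {node X (t ∷ [])}) (below (here refl) x) (below (here refl) y)
    on-top = Eq.gmap (below (here refl)) λ (p , m , l) → down p , m , l

    absent : ∀ {t} → All (v ∉_) (postorder (t ∷ [])) → (x : Node (t ∷ [])) → v ∉ label x
    absent none x = All.lookup none (label∈postorder x)

  connected-leaf : ∀ X → Connected (node X [])
  connected-leaf X (root (here refl)) (root (here refl)) _ _ = Star.ε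
  connected-leaf X (below (here refl) (root ())) _ _ _
  connected-leaf X (below (here refl) (below () _)) _ _ _
  connected-leaf X _ (below (here refl) (root ())) _ _
  connected-leaf X _ (below (here refl) (below () _)) _ _

  connected-new : ∀ {t} X → All (v ∉_) (postorder (t ∷ [])) → Connected (node X (t ∷ []))
  connected-new X none x y m l with pathView x | pathView y
  ... | topmost    | topmost    = Star.ε
  ... | beneath x | _        = contradiction m (absent none x)
  ... | _        | beneath y = contradiction l (absent none y)

  connected-absent : ∀ {t X} → v ∉ X → Connected t → Connected (node X (t ∷ []))
  connected-absent v∉X c x y m l with pathView x | pathView y
  ... | topmost    | _        = contradiction m v∉X
  ... | _        | topmost    = contradiction l v∉X
  ... | beneath x | beneath y = on-top (c x y m l)

  connected-link : ∀ {t X} → v ∈ X → v ∈ rootLabel t → Connected t → Connected (node X (t ∷ []))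
  connected-link {t} {X} v∈X v∈t c x y m l with pathView x | pathView y
  ... | topmost    | topmost    = Star.ε
  ... | beneath x | beneath y = on-top (c x y m l)
  ... | topmost    | beneath y = fwd (top , v∈X , v∈t) ◅ on-top (c (root (here refl)) y v∈t l)
  ... | beneath x | topmost    = on-top (c x (root (here refl)) m v∈t) ◅◅ bwd (top , v∈X , v∈t) ◅ Star.ε

  private
    grow-after : ∀ {t Xs} → Connected t → All (v ∉_) Xs → Connected (grow t Xs)
    grow-after c []       = c
    grow-after c (p ∷ ps) = grow-after (connected-absent p c) ps

    grow-during : ∀ {t Xs Ys} → Connected t → v ∈ rootLabel t → All (v ∈_) Xs → All (v ∉_) Ys →
      Connected (grow t (Xs ++ Ys))
    grow-during c m []       qs = grow-after c qs
    grow-during c m (p ∷ ps) qs = grow-during (connected-link p m c) p ps qs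

    grow-before : ∀ {t Xs Ys Zs} → All (v ∉_) (postorder (t ∷ [])) → Connected t →
      All (v ∉_) Xs → All (v ∈_) Ys → All (v ∉_) Zs → Connected (grow t (Xs ++ Ys ++ Zs))
    grow-before none c []       []       rs = grow-after c rs
    grow-before none c []       (q ∷ qs) rs = grow-during (connected-new _ none) q qs rs
    grow-before none c (p ∷ ps) qs       rs =
      grow-before (All.++⁺ none (p ∷ [])) (connected-absent p c) ps qs rs

  -- While bags are stacked, `v` is absent, then present, then absent; the cases tell in which phase
  -- the lowest bag lies.
  grow-connected : ∀ X Xs → Interval v (X ∷ Xs) → Connected (grow (node X []) Xs)
  grow-connected X Xs (interval [] [] (_ ∷ as) refl _ _ (_ ∷ ps)) = grow-after (connected-leaf X) ps
  grow-connected X Xs (interval [] (_ ∷ ds) as refl _ (q ∷ qs) ps) =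
    grow-during (connected-leaf X) q qs ps
  grow-connected X Xs (interval (_ ∷ bs) ds as refl (p ∷ ps) qs rs) =
    grow-before (p ∷ []) (connected-leaf X) ps qs rs

module Elimination {n} (F : Forest (Fin n)) (G : Graph n)
  (unique : Unique (postorder F)) (complete : ∀ v → v ∈ˡ postorder F)
  (edges : ∀ (x y : Node F) → Adj G (label x) (label y) → Ancestor x y ⊎ Ancestor y x) where

  treedepthDecomposition : TreedepthDecomposition G
  treedepthDecomposition = record
    { forest = F
    ; once   = λ v → let x , e = postorder∋ F (complete v) in
                 x , e , λ {y} e′ → label-injective F unique x y (trans e (sym e′))
    ; edges  = edges
    }

  module _ (X : Subset n) (Xs : List (Subset n)) (list : bagsOf ⊥ F ≡ X ∷ Xs) where

    private
      t : Tree (Subset n)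
      t = grow (node X []) Xs

      bag-node : (x : Node F) → ∃ λ (y : Node (t ∷ [])) → label y ≡ bag ⊥ x
      bag-node x =
        postorder∋ (t ∷ []) (subst (bag ⊥ x ∈ˡ_) (trans list (sym (postorder-grow (node X []) Xs))) (bag∈bagsOf ⊥ x))

      cover : (x : Node F) → ∃ λ (y : Node (t ∷ [])) → ∀ {u} → u ∈ bag ⊥ x → u ∈ label y
      cover x with y , e ← bag-node x = y , subst (_ ∈_) (sym e)

      -- The separator at the lower node contains all its ancestors.
      ancestor-cover : ∀ {x y} → Ancestor x y →
        ∃ λ (z : Node (t ∷ [])) → label x ∈ label z × label y ∈ label z
      ancestor-cover {x} {y} s with z , c ← cover y =
        z , c (ancestor-bag ⊥ s (label∈bag ⊥ x)) , c (label∈bag ⊥ y)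

    pathDecomposition : PathDecomposition G
    pathDecomposition = record
      { treeDecomposition = record
        { tree            = t
        ; covers-vertices = covers-vertices
        ; covers-edges    = covers-edges
        ; connected       =
          λ v → grow-connected v X Xs (subst (Interval v) list (bagsOf-interval ⊥ F unique ∉⊥))
        }
      ; isPath = isPath-grow leaf Xs
      }
      where
      covers-vertices : ∀ v → ∃ λ (x : Node (t ∷ [])) → v ∈ label x
      covers-vertices v with x , refl ← postorder∋ F (complete v) with y , c ← cover x =
        y , c (label∈bag ⊥ x)

      covers-edges : ∀ u v → Adj G u v → ∃ λ (x : Node (t ∷ [])) → u ∈ label x × v ∈ label x
      covers-edges u v a
        with x , refl ← postorder∋ F (complete u) | y , refl ← postorder∋ F (complete v)
        with edges x y a
      ... | inj₁ s = ancestor-cover s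
      ... | inj₂ s with z , m , l ← ancestor-cover s = z , l , m

-- Chains and concatenations of forests

module _ {A : Set} where

  chain : List A → Forest A → Forest A
  chain []       F = F
  chain (a ∷ as) F = node a (chain as F) ∷ []

  under : ∀ as {F : Forest A} → Node F → Node (chain as F)
  under []       x = x
  under (a ∷ as) x = below (here refl) (under as x)

  onChain : ∀ {a as} {F : Forest A} → a ∈ˡ as → Node (chain as F)
  onChain (here refl) = root (here refl)
  onChain (there m)   = below (here refl) (onChain m)

  label-under : ∀ as {F : Forest A} (x : Node F) → label (under as x) ≡ label x
  label-under []       x = refl
  label-under (a ∷ as) x = label-under as x

  label-onChain : ∀ {a as} {F : Forest A} (m : a ∈ˡ as) → label (onChain {F = F} m) ≡ a
  label-onChain (here refl) = refl
  label-onChain (there m)   = label-onChain m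

  below-ancestor : ∀ {a} {F G : Forest A} (i : node a G ∈ˡ F) {x y : Node G} →
    Ancestor x y → Ancestor (below i x) (below i y)
  below-ancestor i = Star.gmap (below i) down

  under-ancestor : ∀ as {F : Forest A} {x y : Node F} → Ancestor x y →
    Ancestor (under as x) (under as y)
  under-ancestor []       s = s
  under-ancestor (a ∷ as) s = below-ancestor _ (under-ancestor as s)

  onChain-ancestor : ∀ {a as} {F : Forest A} (m : a ∈ˡ as) (x : Node F) →
    Ancestor (onChain m) (under as x)
  onChain-ancestor {as = _ ∷ as} (here refl) x = root-ancestor (here refl) (under as x)
  onChain-ancestor (there m)   x = below-ancestor _ (onChain-ancestor m x)

  height-chain : ∀ as (F : Forest A) → height (chain as F) ≡ length as + height F
  height-chain []       F = refl
  height-chain (a ∷ as) F = cong suc (height-chain as F)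

  height-++ : ∀ (F G : Forest A) → height (F ++ G) ≡ height F ⊔ height G
  height-++ []             G = refl
  height-++ (node a H ∷ F) G =
    trans (cong (suc (height H) ⊔_) (height-++ F G)) (sym (ℕ.⊔-assoc (suc (height H)) (height F) (height G)))

  height-tabulate : ∀ {m h} (f : Fin m → Tree A) → Fin m → (∀ i → height (f i ∷ []) ≡ h) →
    height (tabulate f) ≡ h
  height-tabulate {suc zero}    f _ eq = eq zero
  height-tabulate {suc (suc m)} {h} f _ eq = begin
    height (tabulate f)
      ≡⟨ height-++ (f zero ∷ []) (tabulate (f ∘ suc)) ⟩
    height (f zero ∷ []) ⊔ height (tabulate (f ∘ suc))
      ≡⟨ cong₂ _⊔_ (eq zero) (height-tabulate (f ∘ suc) zero (eq ∘ suc)) ⟩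
    h ⊔ h                                                     ≡⟨ ℕ.⊔-idem h ⟩
    h                                                         ∎
    where open ≡-Reasoning

  postorder-++ : ∀ (F G : Forest A) → postorder (F ++ G) ≡ postorder F ++ postorder G
  postorder-++ []             G = refl
  postorder-++ (node a H ∷ F) G =
    trans (cong (λ z → postorder H ++ a ∷ z) (postorder-++ F G))
      (sym (++-assoc (postorder H) (a ∷ postorder F) (postorder G)))

  length-postorder-chain : ∀ as (F : Forest A) →
    length (postorder (chain as F)) ≡ length as + length (postorder F)
  length-postorder-chain []       F = refl
  length-postorder-chain (a ∷ as) F =
    trans (length-++ (postorder (chain as F)))
      (trans (ℕ.+-comm _ 1) (cong suc (length-postorder-chain as F)))

  length-postorder-tabulate : ∀ {m c} (f : Fin m → Tree A) →
    (∀ i → length (postorder (f i ∷ [])) ≡ c) → length (postorder (tabulate f)) ≡ m ℕ.* c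
  length-postorder-tabulate {zero}  f eq = refl
  length-postorder-tabulate {suc m} f eq =
    trans (cong length (postorder-++ (f zero ∷ []) (tabulate (f ∘ suc))))
      (trans (length-++ (postorder (f zero ∷ [])))
        (cong₂ _+_ (eq zero) (length-postorder-tabulate (f ∘ suc) (eq ∘ suc))))

  all-postorder-tabulate : ∀ {m} {Q : A → Set} (f : Fin m → Tree A) →
    (∀ i → All Q (postorder (f i ∷ []))) → All Q (postorder (tabulate f))
  all-postorder-tabulate {zero}  f qs = []
  all-postorder-tabulate {suc m} {Q} f qs =
    subst (All Q) (sym (postorder-++ (f zero ∷ []) (tabulate (f ∘ suc))))
      (All.++⁺ (qs zero) (all-postorder-tabulate (f ∘ suc) (qs ∘ suc)))

rootPaths-++ : ∀ {n} A (F G : Forest (Fin n)) → rootPaths A (F ++ G) ≡ rootPaths A F ++ rootPaths A G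
rootPaths-++ A []             G = refl
rootPaths-++ A (node a H ∷ F) G = cong (_ ∷_) (rootPaths-++ A F G)

bagsOf-++ : ∀ {n} A (F G : Forest (Fin n)) → bagsOf A (F ++ G) ≡ bagsOf A F ++ bagsOf A G
bagsOf-++ A F G =
  trans (cong postorder (rootPaths-++ A F G)) (postorder-++ (rootPaths A F) (rootPaths A G))

adjoin : ∀ {n} → Subset n → List (Fin n) → Subset n
adjoin A []       = A
adjoin A (a ∷ as) = adjoin (A ∪ ⁅ a ⁆) as

chainBags : ∀ {n} → Subset n → List (Fin n) → List (Subset n)
chainBags A []       = []
chainBags A (a ∷ as) = chainBags (A ∪ ⁅ a ⁆) as ++ (A ∪ ⁅ a ⁆) ∷ []

-- Postorder visits the nodes of a chain only after the forest below it is finished.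
bagsOf-chain : ∀ {n} A as (F : Forest (Fin n)) →
  bagsOf A (chain as F) ≡ bagsOf (adjoin A as) F ++ chainBags A as
bagsOf-chain A []       F = sym (++-identityʳ _)
bagsOf-chain A (a ∷ as) F =
  trans (cong (_++ (A ∪ ⁅ a ⁆) ∷ []) (bagsOf-chain (A ∪ ⁅ a ⁆) as F))
    (++-assoc (bagsOf (adjoin (A ∪ ⁅ a ⁆) as) F) _ _)

module _ {n} (Q : Fin n → Set) where

  ∪⁅⁆-within : ∀ {A a} → (∀ {v} → v ∈ A → Q v) → Q a → ∀ {v} → v ∈ A ∪ ⁅ a ⁆ → Q v
  ∪⁅⁆-within {A} {a} q p m with x∈p∪q⁻ A ⁅ a ⁆ m
  ... | inj₁ l = q l
  ... | inj₂ l with refl ← x∈⁅y⁆⇒x≡y a l = p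

  adjoin-within : ∀ {A as} → (∀ {v} → v ∈ A → Q v) → All Q as → ∀ {v} → v ∈ adjoin A as → Q v
  adjoin-within q []       = q
  adjoin-within q (p ∷ ps) = adjoin-within (∪⁅⁆-within q p) ps

  chainBags-within : ∀ {A as} → (∀ {v} → v ∈ A → Q v) → All Q as →
    All (λ X → ∀ {v} → v ∈ X → Q v) (chainBags A as)
  chainBags-within q []       = []
  chainBags-within q (p ∷ ps) =
    All.++⁺ (chainBags-within (∪⁅⁆-within q p) ps) ((λ {_} → ∪⁅⁆-within q p) ∷ [])

-- Traversals

bag-visits : ∀ {n} P (F : Forest (Subset n)) → map Visit.bag (visits P F) ≡ postorder F
bag-visits P []             = refl
bag-visits P (node X F ∷ G) =
  trans (map-++ Visit.bag (visits X F) _) (cong₂ (λ x y → x ++ X ∷ y) (bag-visits X F) (bag-visits P G))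

map≡++ : ∀ {A B : Set} {f : A → B} xs ys {zs} → map f xs ≡ ys ++ zs →
  ∃₂ λ xs₁ xs₂ → xs ≡ xs₁ ++ xs₂ × map f xs₁ ≡ ys × map f xs₂ ≡ zs
map≡++ xs       []       e = [] , xs , refl , refl , e
map≡++ (x ∷ xs) (y ∷ ys) e with refl , e′ ← ∷-injective e
  with xs₁ , xs₂ , refl , e₁ , e₂ ← map≡++ xs ys e′ =
    x ∷ xs₁ , xs₂ , refl , cong (_ ∷_) e₁ , e₂

module VisitCodes {τ} (E : Encoding τ) where
  open Encoding E

  visitCode : ∀ {n} → ℕ → Graph n → List (Visit n) → Word
  visitCode k G = concatMap λ V → sepCode k V ++ edgeCode k V G

  -- Separator codes do not see the graph, and edge codes see it only inside the bag.
  visitCode-local : ∀ {n} k {G H : Graph n} Vs → All (λ X → AgreeOn X G H) (map Visit.bag Vs) →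
    visitCode k G Vs ≡ visitCode k H Vs
  visitCode-local k []       []       = refl
  visitCode-local k (V ∷ Vs) (p ∷ ps) =
    cong₂ (λ c d → (sepCode k V ++ c) ++ d) (edges-local k V _ _ p) (visitCode-local k Vs ps)

-- The family of instances and its encodings

-- Width or depth of the instances minus `w`: the depth is `b + 9` with `b = suc w`, and the width
-- is one less.
overhead : Kind → ℕ
overhead tree      = 9
overhead path      = 9
overhead treedepth = 10

module Family {M w : ℕ} (code : Fin M → Fin (suc w) → Digit) (v₀ : Fin M) where

  private
    b = suc w
  open Gadgets code
  open Inverse

  boundary : Fin b → Fin order
  boundary i = ⟦ bnd i ⟧

  spine : List (Fin order)
  spine = tabulate boundary ++ ⟦ hub₀ ⟧ ∷ ⟦ hub₁ ⟧ ∷ []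

  wire : Fin M → Fin b → Tree (Fin order)
  wire v i = node ⟦ outer v i ⟧ (node ⟦ middle v i ⟧ (node ⟦ inner v i ⟧ [] ∷ []) ∷ [])

  switch : Fin M → List (Fin order)
  switch v = ⟦ on v ⟧ ∷ ⟦ pin v ⟧ ∷ ⟦ off v ⟧ ∷ []

  gadget : Fin M → Tree (Fin order)
  gadget v = node ⟦ token v ⟧ (chain (switch v) (tabulate (wire v)))

  query : Fin b → Tree (Fin order)
  query i = node ⟦ query₀ i ⟧ (node ⟦ query₁ i ⟧ [] ∷ [])

  -- The order matters: the traversal has to pass every token before it meets a query vertex.
  limbs : Forest (Fin order)
  limbs = tabulate gadget ++ tabulate query

  forest : Forest (Fin order)
  forest = chain spine limbs

  private
    g∈ : ∀ v → gadget v ∈ˡ limbs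
    g∈ v = ∈-++⁺ˡ (∈-tabulate⁺ {f = gadget} v)

    q∈ : ∀ i → query i ∈ˡ limbs
    q∈ i = ∈-++⁺ʳ (tabulate gadget) (∈-tabulate⁺ {f = query} i)

    w∈ : ∀ v i → wire v i ∈ˡ tabulate (wire v)
    w∈ v i = ∈-tabulate⁺ {f = wire v} i

    first : ∀ {A : Set} {t : A} {ts} → t ∈ˡ (t ∷ ts)
    first = here refl

    bnd∈ : ∀ i → ⟦ bnd i ⟧ ∈ˡ spine
    bnd∈ i = ∈-++⁺ˡ (∈-tabulate⁺ {f = boundary} i)

    hub₀∈ : ⟦ hub₀ ⟧ ∈ˡ spine
    hub₀∈ = ∈-++⁺ʳ (tabulate boundary) (here refl)

    hub₁∈ : ⟦ hub₁ ⟧ ∈ˡ spine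
    hub₁∈ = ∈-++⁺ʳ (tabulate boundary) (there (here refl))

    inWire : ∀ v i → Node (node ⟦ middle v i ⟧ (node ⟦ inner v i ⟧ [] ∷ []) ∷ []) →
      Node (chain (switch v) (tabulate (wire v)))
    inWire v i x = under (switch v) (below (w∈ v i) x)

    limb : V → Node limbs ⊎ ∃ (_∈ˡ spine)
    limb (bnd i)      = inj₂ (_ , bnd∈ i)
    limb hub₀         = inj₂ (_ , hub₀∈)
    limb hub₁         = inj₂ (_ , hub₁∈)
    limb (token v)    = inj₁ (root (g∈ v))
    limb (on v)       = inj₁ (below (g∈ v) (root first))
    limb (pin v)      = inj₁ (below (g∈ v) (below first (root first)))
    limb (off v)      = inj₁ (below (g∈ v) (below first (below first (root first))))
    limb (outer v i)  = inj₁ (below (g∈ v) (under (switch v) (root (w∈ v i))))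
    limb (middle v i) = inj₁ (below (g∈ v) (inWire v i (root first)))
    limb (inner v i)  = inj₁ (below (g∈ v) (inWire v i (below first (root first))))
    limb (query₀ i)   = inj₁ (root (q∈ i))
    limb (query₁ i)   = inj₁ (below (q∈ i) (root first))

  nodeOf : V → Node forest
  nodeOf u = [ under spine , (λ (_ , m) → onChain m) ]′ (limb u)

  label-nodeOf : ∀ u → label (nodeOf u) ≡ ⟦ u ⟧
  label-nodeOf (bnd i)      = label-onChain {F = limbs} (bnd∈ i)
  label-nodeOf hub₀         = label-onChain {F = limbs} hub₀∈
  label-nodeOf hub₁         = label-onChain {F = limbs} hub₁∈
  label-nodeOf (token v)    = label-under spine _
  label-nodeOf (on v)       = label-under spine _
  label-nodeOf (pin v)      = label-under spine _
  label-nodeOf (off v)      = label-under spine _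
  label-nodeOf (outer v i)  = label-under spine _
  label-nodeOf (middle v i) = label-under spine _
  label-nodeOf (inner v i)  = label-under spine _
  label-nodeOf (query₀ i)   = label-under spine _
  label-nodeOf (query₁ i)   = label-under spine _

  edge-ancestor : ∀ {L r u z} → Edge L r u z → Ancestor (nodeOf z) (nodeOf u)
  edge-ancestor (token-hub₀ _) = onChain-ancestor hub₀∈ _
  edge-ancestor (token-hub₁ _) = onChain-ancestor hub₁∈ _
  edge-ancestor (pin-on {v}) = under-ancestor spine (below-ancestor (g∈ v) (root-ancestor first _))
  edge-ancestor (off-token {v}) = under-ancestor spine (root-ancestor (g∈ v) _)
  edge-ancestor (off-on {v}) = under-ancestor spine (below-ancestor (g∈ v) (root-ancestor first _))
  edge-ancestor (off-pin {v}) =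
    under-ancestor spine (below-ancestor (g∈ v) (below-ancestor first (root-ancestor first _)))
  edge-ancestor (outer-bnd {v} {i} _) = onChain-ancestor (bnd∈ i) _
  edge-ancestor (outer-off {v} {i} _) =
    under-ancestor spine (below-ancestor (g∈ v)
      (below-ancestor first (below-ancestor first (root-ancestor first _))))
  edge-ancestor (middle-outer {v} {i} _) =
    under-ancestor spine (below-ancestor (g∈ v) (under-ancestor (switch v) (root-ancestor (w∈ v i) _)))
  edge-ancestor (inner-middle {v} {i}) =
    under-ancestor spine (below-ancestor (g∈ v)
      (under-ancestor (switch v) (below-ancestor (w∈ v i) (root-ancestor first _))))
  edge-ancestor (inner-on {v} {i} _) =
    under-ancestor spine (below-ancestor (g∈ v) (root-ancestor first _))
  edge-ancestor (query₀-bnd {i} _) = onChain-ancestor (bnd∈ i) _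
  edge-ancestor (query₁-bnd {i} _) = onChain-ancestor (bnd∈ i) _
  edge-ancestor (query₁-query₀ {i} _) = under-ancestor spine (root-ancestor (q∈ i) _)

  length-spine : length spine ≡ b + 2
  length-spine = trans (length-++ (tabulate boundary)) (cong (_+ 2) (length-tabulate boundary))

  length-forest : length (postorder forest) ≡ order
  length-forest = begin
    length (postorder forest)                      ≡⟨ length-postorder-chain spine limbs ⟩
    length spine + length (postorder limbs)
      ≡⟨ cong₂ _+_ length-spine (cong length (postorder-++ (tabulate gadget) (tabulate query))) ⟩
    b + 2 + length (postorder (tabulate gadget) ++ postorder (tabulate query))
      ≡⟨ cong (_+_ (b + 2)) (length-++ (postorder (tabulate gadget))) ⟩
    b + 2 + (length (postorder (tabulate gadget)) + length (postorder (tabulate query)))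
      ≡⟨ cong (_+_ (b + 2)) (cong₂ _+_ (length-postorder-tabulate gadget length-gadget) (length-postorder-tabulate query λ _ → refl)) ⟩
    b + 2 + (M ℕ.* (4 + b ℕ.* 3) + b ℕ.* 2)              ≡⟨ ℕ.+-assoc b 2 _ ⟩
    order                                          ∎
    where
    open ≡-Reasoning
    length-gadget : ∀ v → length (postorder (gadget v ∷ [])) ≡ 4 + b ℕ.* 3
    length-gadget v = trans (length-postorder-chain (⟦ token v ⟧ ∷ switch v) (tabulate (wire v)))
      (cong (_+_ 4) (length-postorder-tabulate (wire v) λ _ → refl))

  height-forest : height forest ≡ b + 9
  height-forest = begin
    height forest                ≡⟨ height-chain spine limbs ⟩
    length spine + height limbs
      ≡⟨ cong₂ _+_ length-spine (height-++ (tabulate gadget) (tabulate query)) ⟩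
    b + 2 + (height (tabulate gadget) ⊔ height (tabulate query))
      ≡⟨ cong (_+_ (b + 2)) (cong₂ _⊔_ (height-tabulate gadget v₀ height-gadget) (height-tabulate query zero λ _ → refl)) ⟩
    b + 2 + 7                    ≡⟨ ℕ.+-assoc b 2 7 ⟩
    b + 9                        ∎
    where
    open ≡-Reasoning
    height-gadget : ∀ v → height (gadget v ∷ []) ≡ 7
    height-gadget v = trans (height-chain (⟦ token v ⟧ ∷ switch v) (tabulate (wire v)))
      (cong (_+_ 4) (height-tabulate (wire v) zero λ _ → refl))

  complete : ∀ x → x ∈ˡ postorder forest
  complete x = subst (_∈ˡ postorder forest) (trans (label-nodeOf (to vertex x)) (⟦⟧-from x))
    (label∈postorder (nodeOf (to vertex x)))

  unique : Unique (postorder forest)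
  unique = complete⇒unique (postorder forest) (ℕ.≤-reflexive length-forest) complete

  node≡ : ∀ x → nodeOf (to vertex (label x)) ≡ x
  node≡ x = label-injective forest unique _ x (trans (label-nodeOf _) (⟦⟧-from (label x)))

  edges : ∀ {L r} (x y : Node forest) → Adj (gadgetGraph L r) (label x) (label y) →
    Ancestor x y ⊎ Ancestor y x
  edges {L} {r} x y a with adj⇒Nbr {L} {r} {label x} {label y} a
  ... | inj₁ e = inj₂ (subst₂ Ancestor (node≡ y) (node≡ x) (edge-ancestor e))
  ... | inj₂ e = inj₁ (subst₂ Ancestor (node≡ x) (node≡ y) (edge-ancestor e))

  private
    cons : ∀ {A : Set} {m} (xs : List A) → length xs ≡ suc m → ∃₂ λ y ys → xs ≡ y ∷ ys
    cons (x ∷ xs) _ = x , xs , refl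

    bags≡∷ : ∃₂ λ X Xs → bagsOf ⊥ forest ≡ X ∷ Xs
    bags≡∷ = cons (bagsOf ⊥ forest) (trans (length-bagsOf ⊥ forest) length-forest)

    pathTree : Tree (Subset order)
    pathTree = grow (node (proj₁ bags≡∷) []) (proj₁ (proj₂ bags≡∷))

  module _ (L : Fin M → Bool) (r : Fin b → Digit) where
    open Elimination forest (gadgetGraph L r) unique complete edges

    decomposition : ∀ τ → Decomposition τ (gadgetGraph L r)
    decomposition treedepth = treedepthDecomposition
    decomposition path      = pathDecomposition (proj₁ bags≡∷) _ (proj₂ (proj₂ bags≡∷))
    decomposition tree      = PathDecomposition.treeDecomposition (decomposition path)

    inst : ∀ τ → Instance τ
    inst τ = record { graph = gadgetGraph L r ; decomp = decomposition τ ; ξ = + cells }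

  -- Neither `L` nor `r` enters here, so all instances of a kind share one sequence of visits.
  sepForest : Kind → Forest (Subset order)
  sepForest treedepth = rootPaths ⊥ forest
  sepForest tree      = pathTree ∷ []
  sepForest path      = pathTree ∷ []

  seps-inst : ∀ τ L r → Instance.seps (inst L r τ) ≡ sepForest τ
  seps-inst tree      L r = refl
  seps-inst path      L r = refl
  seps-inst treedepth L r = refl

  postorder-sepForest : ∀ τ → postorder (sepForest τ) ≡ bagsOf ⊥ forest
  postorder-sepForest treedepth = refl
  postorder-sepForest tree      = trans (postorder-grow (node _ []) _) (sym (proj₂ (proj₂ bags≡∷)))
  postorder-sepForest path      = postorder-sepForest tree

  size-inst : ∀ τ L r → Instance.size (inst L r τ) ≡ order
  size-inst τ L r = begin
    length (postorder (Instance.seps (inst L r τ))) ≡⟨ cong (length ∘ postorder) (seps-inst τ L r) ⟩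
    length (postorder (sepForest τ))                ≡⟨ cong length (postorder-sepForest τ) ⟩
    length (bagsOf ⊥ forest)                        ≡⟨ length-bagsOf ⊥ forest ⟩
    length (postorder forest)                       ≡⟨ length-forest ⟩
    order                                           ∎
    where open ≡-Reasoning

  k-inst : ∀ τ L r → Instance.k (inst L r τ) ≡ overhead τ + w
  k-inst treedepth L r = trans height-forest (ℕ.+-comm b 9)
  k-inst path      L r = k-inst tree L r
  k-inst tree      L r = cong pred (begin
    largest (postorder (sepForest tree)) ≡⟨ cong largest (postorder-sepForest tree) ⟩
    largest (bagsOf ⊥ forest)            ≡⟨ largest-bagsOf forest unique ⟩
    height forest                        ≡⟨ height-forest ⟩
    b + 9                                ≡⟨ ℕ.+-comm b 9 ⟩
    10 + w                               ∎)
    where open ≡-Reasoning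

  NotToken NotQuery : V → Set
  NotToken u = ∀ v → u ≢ token v
  NotQuery u = ∀ i → u ≢ query₀ i × u ≢ query₁ i

  -- Only edges whose lower end is a token depend on `L`, just as only those whose lower end is a
  -- query vertex depend on `r`.
  relabel : ∀ {L L′ r u z} → NotToken u → Edge L r u z → Edge L′ r u z
  relabel n (token-hub₀ _)     = contradiction refl (n _)
  relabel n (token-hub₁ _)     = contradiction refl (n _)
  relabel n pin-on             = pin-on
  relabel n off-token          = off-token
  relabel n off-on             = off-on
  relabel n off-pin            = off-pin
  relabel n (outer-bnd x)      = outer-bnd x
  relabel n (outer-off x)      = outer-off x
  relabel n (middle-outer x)   = middle-outer x
  relabel n inner-middle       = inner-middle
  relabel n (inner-on x)       = inner-on x
  relabel n (query₀-bnd x)     = query₀-bnd x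
  relabel n (query₁-bnd x)     = query₁-bnd x
  relabel n (query₁-query₀ x)  = query₁-query₀ x

  requery : ∀ {L r r′ u z} → NotQuery u → Edge L r u z → Edge L r′ u z
  requery n (token-hub₀ x)     = token-hub₀ x
  requery n (token-hub₁ x)     = token-hub₁ x
  requery n pin-on             = pin-on
  requery n off-token          = off-token
  requery n off-on             = off-on
  requery n off-pin            = off-pin
  requery n (outer-bnd x)      = outer-bnd x
  requery n (outer-off x)      = outer-off x
  requery n (middle-outer x)   = middle-outer x
  requery n inner-middle       = inner-middle
  requery n (inner-on x)       = inner-on x
  requery n (query₀-bnd x)     = contradiction refl (proj₁ (n _))
  requery n (query₁-bnd x)     = contradiction refl (proj₂ (n _))
  requery n (query₁-query₀ x)  = contradiction refl (proj₂ (n _))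

  module _ {L L′ : Fin M → Bool} {r r′ : Fin b → Digit} where

    agree : ∀ (Q : V → Set) →
      (∀ {u z} → Q u → Edge L r u z → Edge L′ r′ u z) →
      (∀ {u z} → Q u → Edge L′ r′ u z → Edge L r u z) →
      ∀ {X} → (∀ {x} → x ∈ X → Q (to vertex x)) → AgreeOn X (gadgetGraph L r) (gadgetGraph L′ r′)
    agree Q f g q x y x∈X y∈X = does-⇔
      (mk⇔ (Sum.map (f (q x∈X)) (f (q y∈X))) (Sum.map (g (q x∈X)) (g (q y∈X))))
      (nbr? L r (to vertex x) (to vertex y)) (nbr? L′ r′ (to vertex x) (to vertex y))

  private
    A₀ : Subset order
    A₀ = adjoin ⊥ spine

    bags₁ bags₂ : List (Subset order)
    bags₁ = bagsOf A₀ (tabulate gadget)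
    bags₂ = bagsOf A₀ (tabulate query) ++ chainBags ⊥ spine

    bags-split : bagsOf ⊥ forest ≡ bags₁ ++ bags₂
    bags-split = trans (bagsOf-chain ⊥ spine limbs)
      (trans (cong (_++ chainBags ⊥ spine) (bagsOf-++ A₀ (tabulate gadget) (tabulate query)))
        (++-assoc bags₁ _ _))

    module _ (Q : V → Set) where

      Q′ : Fin order → Set
      Q′ x = Q (to vertex x)

      at : ∀ {u} → Q u → Q′ ⟦ u ⟧
      at {u} = subst Q (sym (to-⟦⟧ u))

      spine-within : (∀ i → Q (bnd i)) → Q hub₀ → Q hub₁ → All Q′ spine
      spine-within q₀ q₁ q₂ = All.++⁺ (All.tabulate⁺ λ i → at (q₀ i)) (at q₁ ∷ at q₂ ∷ [])

    bags₁-within : All (λ X → ∀ {x} → x ∈ X → NotQuery (to vertex x)) bags₁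
    bags₁-within = bagsOf-within (Q′ NotQuery) A₀ (tabulate gadget)
      (adjoin-within (Q′ NotQuery) (λ m → contradiction m ∉⊥)
        (spine-within NotQuery (λ _ _ → (λ ()) , λ ()) (λ _ → (λ ()) , λ ()) (λ _ → (λ ()) , λ ())))
      (all-postorder-tabulate gadget λ v →
        all-chain (⟦ token v ⟧ ∷ switch v) (tabulate (wire v))
          (at NotQuery (λ _ → (λ ()) , λ ()) ∷ at NotQuery (λ _ → (λ ()) , λ ())
            ∷ at NotQuery (λ _ → (λ ()) , λ ()) ∷ at NotQuery (λ _ → (λ ()) , λ ()) ∷ [])
          (all-postorder-tabulate (wire v) λ i →
            at NotQuery (λ _ → (λ ()) , λ ()) ∷ at NotQuery (λ _ → (λ ()) , λ ())
              ∷ at NotQuery (λ _ → (λ ()) , λ ()) ∷ []))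
      where
      all-chain : ∀ {Q : Fin order → Set} as (F : Forest (Fin order)) → All Q as → All Q (postorder F) →
        All Q (postorder (chain as F))
      all-chain []       F []       qs = qs
      all-chain (a ∷ as) F (p ∷ ps) qs = All.++⁺ (all-chain as F ps qs) (p ∷ [])

    bags₂-within : All (λ X → ∀ {x} → x ∈ X → NotToken (to vertex x)) bags₂
    bags₂-within = All.++⁺
      (bagsOf-within (Q′ NotToken) A₀ (tabulate query)
        (adjoin-within (Q′ NotToken) (λ m → contradiction m ∉⊥) sp)
        (all-postorder-tabulate query λ i → at NotToken (λ _ ()) ∷ at NotToken (λ _ ()) ∷ []))
      (chainBags-within (Q′ NotToken) (λ m → contradiction m ∉⊥) sp)
      where
      sp : All (Q′ NotToken) spine
      sp = spine-within NotToken (λ _ _ ()) (λ _ ()) (λ _ ())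

  module _ {τ} (E : Encoding τ) where
    open Encoding E
    open VisitCodes E

    private
      -- Placeholders for the argument that a part of the code does not see.
      L₀ : Fin M → Bool
      L₀ _ = false

      r₀ : Fin b → Digit
      r₀ = code v₀

      split : ∃₂ λ Vs₁ Vs₂ → visits ⊥ (sepForest τ) ≡ Vs₁ ++ Vs₂ ×
                map Visit.bag Vs₁ ≡ bags₁ × map Visit.bag Vs₂ ≡ bags₂
      split = map≡++ (visits ⊥ (sepForest τ)) bags₁
        (trans (bag-visits ⊥ (sepForest τ)) (trans (postorder-sepForest τ) bags-split))

      Vs₁ Vs₂ : List (Visit order)
      Vs₁ = proj₁ split
      Vs₂ = proj₁ (proj₂ split)

      kᵢ : ℕ
      kᵢ = overhead τ + w

      front : (Fin M → Bool) → Word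
      front L = paramCode kᵢ ++ visitCode kᵢ (gadgetGraph L r₀) Vs₁

      rest : (Fin b → Digit) → Word
      rest r = visitCode kᵢ (gadgetGraph L₀ r) Vs₂ ++ inputCode (+ cells)

      -- Bags of the first part contain no query vertex and those of the second no token, so by
      -- locality of the edge codes each part depends on only one of `L` and `r`.
      encode-inst : ∀ L r → encode (inst L r τ) ≡ front L ++ rest r
      encode-inst L r = begin
        encode (inst L r τ)
          ≡⟨ cong₂ (λ k F → paramCode k ++ visitCode k G (visits ⊥ F) ++ inputCode (+ cells)) (k-inst τ L r) (seps-inst τ L r) ⟩
        paramCode kᵢ ++ visitCode kᵢ G (visits ⊥ (sepForest τ)) ++ inputCode (+ cells)
          ≡⟨ cong (λ Vs → paramCode kᵢ ++ visitCode kᵢ G Vs ++ inputCode (+ cells)) (proj₁ (proj₂ (proj₂ split))) ⟩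
        paramCode kᵢ ++ visitCode kᵢ G (Vs₁ ++ Vs₂) ++ inputCode (+ cells)
          ≡⟨ cong (λ z → paramCode kᵢ ++ z ++ inputCode (+ cells)) (concatMap-++ _ Vs₁ Vs₂) ⟩
        paramCode kᵢ ++ (visitCode kᵢ G Vs₁ ++ visitCode kᵢ G Vs₂) ++ inputCode (+ cells)
          ≡⟨ cong₂ (λ y z → paramCode kᵢ ++ (y ++ z) ++ inputCode (+ cells)) left-code right-code ⟩
        paramCode kᵢ ++ (visitCode kᵢ (gadgetGraph L r₀) Vs₁ ++ visitCode kᵢ (gadgetGraph L₀ r) Vs₂) ++ inputCode (+ cells)
          ≡⟨ cong (paramCode kᵢ ++_) (++-assoc (visitCode kᵢ (gadgetGraph L r₀) Vs₁) _ _) ⟩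
        paramCode kᵢ ++ visitCode kᵢ (gadgetGraph L r₀) Vs₁ ++ rest r
          ≡⟨ ++-assoc (paramCode kᵢ) _ _ ⟨
        front L ++ rest r ∎
        where
        open ≡-Reasoning
        G = gadgetGraph L r

        left-code : visitCode kᵢ G Vs₁ ≡ visitCode kᵢ (gadgetGraph L r₀) Vs₁
        left-code = visitCode-local kᵢ Vs₁ (subst (All _) (sym (proj₁ (proj₂ (proj₂ (proj₂ split)))))
          (All.map (λ q → agree NotQuery requery requery (λ {x} → q {x})) bags₁-within))

        right-code : visitCode kᵢ G Vs₂ ≡ visitCode kᵢ (gadgetGraph L₀ r) Vs₂
        right-code = visitCode-local kᵢ Vs₂ (subst (All _) (sym (proj₂ (proj₂ (proj₂ (proj₂ split)))))
          (All.map (λ q → agree NotToken relabel relabel (λ {x} → q {x})) bags₂-within))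

    module _ (antichain : ∀ {u v} → (∀ i → code u i Fin.≤ code v i) → u ≡ v)
             (lft-first : ∀ v → code v zero ≡ lft)
             (T : DPTM alphabet) (solves : Solves E T DominatingSet) where
      open Run T
      open Cut T
      open Fooling T

      2^M≤outcomes : ∀ s →
        (∀ L c → initial (encode (inst L r₀ τ)) ⟶* c → Tape.cells (Config.work c) ≤ s) →
        2 ℕ.^ M ≤ outcomeCount s
      2^M≤outcomes s space = subsets≤outcomes front rest code r₀
        (λ L r → let b , o , _ = solves (inst L r τ) in
          b , subst (λ z → Outputs z b) (encode-inst L r) o)
        correct
        (λ L c run → space L c (subst (λ z → initial z ⟶* c) (sym (encode-inst L r₀)) run))
        where
        -- A dominating set yields a member of `L` below the query word; in an antichain this is the
        -- query word itself.
        decides : ∀ L i {b} → Reflects (DominatingSet (gadgetGraph L (code i)) (+ cells)) b → b ≡ L i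
        decides L i (ofʸ d) with u , l , le ← dominatingSet⇒ d (lft-first i)
          with refl ← antichain le = sym l
        decides L i (ofⁿ n) with L i in eq
        ... | false = refl
        ... | true  = contradiction (⇒dominatingSet i eq λ _ → refl) n

        correct : ∀ L i b → Outputs (front L ++ rest (code i)) b → b ≡ L i
        correct L i b o with b′ , o′ , reflects ← solves (inst L (code i) τ)
          = trans (outputs-unique o (subst (λ z → Outputs z b′) (encode-inst L (code i)) o′))
              (decides L i reflects)

-- Codes

unique⇒lookup-injective : ∀ {A : Set} {xs : List A} → Unique xs →
  ∀ {i j} → lookup xs i ≡ lookup xs j → i ≡ j
unique⇒lookup-injective (_ ∷ _) {zero}  {zero}  _ = refl
unique⇒lookup-injective (p ∷ _) {zero}  {suc j} e = contradiction e (All.lookup p (∈-lookup j))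
unique⇒lookup-injective (p ∷ _) {suc i} {zero}  e = contradiction (sym e) (All.lookup p (∈-lookup i))
unique⇒lookup-injective (_ ∷ u) {suc i} {suc j} e = cong suc (unique⇒lookup-injective u e)

module _ {A : Set} (f : A → ℕ) where

  class : ℕ → List A → List A
  class c = filter (λ x → f x ℕ.≟ c)

  others : ℕ → List A → List A
  others c = filter (λ x → ¬? (f x ℕ.≟ c))

  length-class+others : ∀ c xs → length xs ≡ length (class c xs) + length (others c xs)
  length-class+others c []       = refl
  length-class+others c (x ∷ xs) with f x ℕ.≡ᵇ c
  ... | true  = cong suc (length-class+others c xs)
  ... | false = trans (cong suc (length-class+others c xs)) (sym (ℕ.+-suc (length (class c xs)) _))

  length-class-others : ∀ c d xs → length (class c (others d xs)) ≤ length (class c xs)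
  length-class-others c d []       = z≤n
  length-class-others c d (x ∷ xs) with f x ℕ.≡ᵇ d
  length-class-others c d (x ∷ xs) | true with f x ℕ.≡ᵇ c
  ... | true  = ℕ.m≤n⇒m≤1+n (length-class-others c d xs)
  ... | false = length-class-others c d xs
  length-class-others c d (x ∷ xs) | false with f x ℕ.≡ᵇ c
  ... | true  = s≤s (length-class-others c d xs)
  ... | false = length-class-others c d xs

  -- Pigeonhole by induction on the number of values: the class of the top value competes with the
  -- class found among the other elements.
  large-class : ∀ m xs → All (λ x → f x ℕ.< m) xs → ∃ λ c → length xs ≤ m ℕ.* length (class c xs)
  large-class zero    []      _        = 0 , z≤n
  large-class zero    (_ ∷ _) (() ∷ _)
  large-class (suc m) xs bound
    with c , le ← large-class m (others m xs)
           (All.map (λ (lt , ne) → ℕ.≤∧≢⇒< (ℕ.s≤s⁻¹ lt) ne)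
             (All.zip (All.filter⁺ _ bound , All.all-filter (λ x → ¬? (f x ℕ.≟ m)) xs)))
    with ℕ.≤-total (length (class m xs)) (length (class c xs))
  ... | inj₁ m≤c = c , (begin
    length xs                                           ≡⟨ length-class+others m xs ⟩
    length (class m xs) + length (others m xs)          ≤⟨ ℕ.+-mono-≤ m≤c le ⟩
    length (class c xs) + m ℕ.* length (class c (others m xs))
      ≤⟨ ℕ.+-monoʳ-≤ (length (class c xs)) (ℕ.*-monoʳ-≤ m (length-class-others c m xs)) ⟩
    suc m ℕ.* length (class c xs)                         ∎)
    where open ℕ.≤-Reasoning
  ... | inj₂ c≤m = m , (begin
    length xs                                           ≡⟨ length-class+others m xs ⟩
    length (class m xs) + length (others m xs)
      ≤⟨ ℕ.+-monoʳ-≤ (length (class m xs)) (ℕ.≤-trans le (ℕ.*-monoʳ-≤ m (ℕ.≤-trans (length-class-others c m xs) c≤m))) ⟩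
    suc m ℕ.* length (class m xs)                         ∎)
    where open ℕ.≤-Reasoning

weight : ∀ {w} → (Fin w → Digit) → ℕ
weight {zero}  f = 0
weight {suc w} f = toℕ (f zero) + weight (f ∘ suc)

weight-≤ : ∀ {w} (f : Fin w → Digit) → weight f ≤ w ℕ.* 2
weight-≤ {zero}  f = z≤n
weight-≤ {suc w} f = ℕ.+-mono-≤ (ℕ.s≤s⁻¹ (Fin.toℕ<n (f zero))) (weight-≤ (f ∘ suc))

weight-mono : ∀ {w} {f g : Fin w → Digit} → (∀ i → f i Fin.≤ g i) → weight f ≤ weight g
weight-mono {zero}  le = z≤n
weight-mono {suc w} le = ℕ.+-mono-≤ (le zero) (weight-mono (le ∘ suc))

-- A strictly smaller digit could not be compensated elsewhere, so the sums would differ.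
weight-antichain : ∀ {w} {f g : Fin w → Digit} → (∀ i → f i Fin.≤ g i) → weight f ≡ weight g →
  ∀ i → f i ≡ g i
weight-antichain {suc w} {f} {g} le e with f zero Fin.≟ g zero
... | no ne =
  contradiction e (ℕ.<⇒≢ (ℕ.+-mono-<-≤ (ℕ.≤∧≢⇒< (le zero) (ne ∘ Fin.toℕ-injective)) (weight-mono (le ∘ suc))))
... | yes e₀ = λ where
  zero    → e₀
  (suc i) → weight-antichain (le ∘ suc) (ℕ.+-cancelˡ-≡ (toℕ (g zero)) _ _
    (subst (λ d → toℕ d + weight (f ∘ suc) ≡ weight g) e₀ e)) i

-- The leading lft makes every query ask for some domination from the left, which
-- forces the gadget of the selected token to be on.
record Code (w : ℕ) : Set where
  field
    M          : ℕ
    code       : Fin M → Fin (suc w) → Digit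
    antichain  : ∀ {u v} → (∀ i → code u i Fin.≤ code v i) → u ≡ v
    lft-first  : ∀ v → code v zero ≡ lft
    large      : 3 ℕ.^ w ≤ (1 + w ℕ.* 2) ℕ.* M
    small      : M ≤ 3 ℕ.^ w

-- Digit sums of words of length `w` take at most `1 + w * 2` values; the codewords are the words
-- with a most suitable sum, found by `large-class`.
constantWeight : ∀ w → Code w
constantWeight w = record
  { M         = length words
  ; code      = code
  ; antichain = λ {u} {v} le → unique⇒lookup-injective unique (word-injective u v le)
  ; lft-first = λ _ → refl
  ; large     =
    subst (_≤ (1 + w ℕ.* 2) ℕ.* length words) (length-tabulate {n = 3 ℕ.^ w} id) (proj₂ popular)
  ; small     =
    subst (length words ≤_) (length-tabulate {n = 3 ℕ.^ w} id) (length-filter _ (allFin (3 ℕ.^ w)))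
  }
  where
  digits : Fin (3 ℕ.^ w) → Fin w → Digit
  digits = finToFun

  popular : ∃ λ c → length (allFin (3 ℕ.^ w)) ≤ (1 + w ℕ.* 2) ℕ.* length (class (λ x → weight (digits x)) c (allFin (3 ℕ.^ w)))
  popular =
    large-class (λ x → weight (digits x)) (1 + w ℕ.* 2) (allFin (3 ℕ.^ w)) (All.tabulate⁺ λ x → s≤s (weight-≤ (digits x)))

  words : List (Fin (3 ℕ.^ w))
  words = class (λ x → weight (digits x)) (proj₁ popular) (allFin (3 ℕ.^ w))

  unique : Unique words
  unique = Unique.filter⁺ _ (Unique.allFin⁺ (3 ℕ.^ w))

  code : Fin (length words) → Fin (suc w) → Digit
  code u zero    = lft
  code u (suc i) = digits (lookup words u) i

  weight-word : ∀ u → weight (digits (lookup words u)) ≡ proj₁ popular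
  weight-word u =
    proj₂ (∈-filter⁻ (λ x → weight (digits x) ℕ.≟ proj₁ popular) {xs = allFin (3 ℕ.^ w)} (∈-lookup u))

  word-injective : ∀ u v → (∀ i → code u i Fin.≤ code v i) → lookup words u ≡ lookup words v
  word-injective u v le = begin
    lookup words u                     ≡⟨ Fin.funToFin-finToFin {w} {3} (lookup words u) ⟨
    funToFin (digits (lookup words u))
      ≡⟨ funToFin-cong (weight-antichain (le ∘ suc) (trans (weight-word u) (sym (weight-word v)))) ⟩
    funToFin (digits (lookup words v)) ≡⟨ Fin.funToFin-finToFin {w} {3} (lookup words v) ⟩
    lookup words v                     ∎
    where open ≡-Reasoning

-- Rational bounds

ι : ℕ → ℚ
ι n = + n / 1

toℚᵘ-ι : ∀ n → toℚᵘ (ι n) ℚᵘ.≃ mkℚᵘ (+ n) 0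
toℚᵘ-ι n = ℚ.toℚᵘ-fromℚᵘ (mkℚᵘ (+ n) 0)

ι-* : ∀ m n → ι (m ℕ.* n) ≡ ι m * ι n
ι-* m n = ℚ.toℚᵘ-injective (begin
  toℚᵘ (ι (m ℕ.* n))                ≈⟨ toℚᵘ-ι (m ℕ.* n) ⟩
  mkℚᵘ (+ (m ℕ.* n)) 0              ≈⟨ *≡* (cong (ℤ._* + 1) (ℤ.pos-* m n)) ⟩
  mkℚᵘ (+ m) 0 ℚᵘ.* mkℚᵘ (+ n) 0    ≈⟨ ℚᵘ.*-cong (toℚᵘ-ι m) (toℚᵘ-ι n) ⟨
  toℚᵘ (ι m) ℚᵘ.* toℚᵘ (ι n)        ≈⟨ ℚ.toℚᵘ-homo-* (ι m) (ι n) ⟨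
  toℚᵘ (ι m * ι n)                  ∎)
  where open ℚᵘ.≃-Reasoning

ι-+ : ∀ m n → ι (m ℕ.+ n) ≡ ι m ℚ.+ ι n
ι-+ m n = ℚ.toℚᵘ-injective (begin
  toℚᵘ (ι (m ℕ.+ n))                ≈⟨ toℚᵘ-ι (m ℕ.+ n) ⟩
  mkℚᵘ (+ (m ℕ.+ n)) 0
    ≈⟨ *≡* (cong (ℤ._* + 1) (trans (ℤ.pos-+ m n) (sym (cong₂ ℤ._+_ (ℤ.*-identityʳ (+ m)) (ℤ.*-identityʳ (+ n)))))) ⟩
  mkℚᵘ (+ m) 0 ℚᵘ.+ mkℚᵘ (+ n) 0    ≈⟨ ℚᵘ.+-cong (toℚᵘ-ι m) (toℚᵘ-ι n) ⟨
  toℚᵘ (ι m) ℚᵘ.+ toℚᵘ (ι n)        ≈⟨ ℚ.toℚᵘ-homo-+ (ι m) (ι n) ⟨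
  toℚᵘ (ι m ℚ.+ ι n)                ∎)
  where open ℚᵘ.≃-Reasoning

ι-cancel-≤ : ∀ {m n} → ι m ℚ.≤ ι n → m ℕ.≤ n
ι-cancel-≤ {m} {n} le
  with *≤* le′ ← ℚᵘ.≤-respʳ-≃ (toℚᵘ-ι n) (ℚᵘ.≤-respˡ-≃ (toℚᵘ-ι m) (ℚ.toℚᵘ-mono-≤ le))
  rewrite ℤ.*-identityʳ (+ m) | ℤ.*-identityʳ (+ n) = ℤ.drop‿+≤+ le′

ι-nonNeg : ∀ n → NonNegative (ι n)
ι-nonNeg n = ℚ.normalize-nonNeg n 1

-- The denominator of `ε` serves, since the numerator is at least one.
archimedean : ∀ ε → 0ℚ < ε → ∃ λ d → 1ℚ ℚ.≤ ε * ι (suc d)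
archimedean (mkℚ (+ 0)       d _) 0<ε = contradiction 0<ε λ where (ℚ.*<* (ℤ.+<+ ()))
archimedean (mkℚ -[1+ _ ]    d _) 0<ε = contradiction 0<ε λ where (ℚ.*<* ())
archimedean ε@(mkℚ (+ suc n) d _) _   = d , ℚ.toℚᵘ-cancel-≤ (begin
  mkℚᵘ (+ 1) 0                                ≤⟨ *≤* (ℤ.+≤+ le) ⟩
  mkℚᵘ (+ suc n) d ℚᵘ.* mkℚᵘ (+ suc d) 0      ≃⟨ ℚᵘ.*-cong (ℚᵘ.≃-refl {toℚᵘ ε}) (toℚᵘ-ι (suc d)) ⟨
  toℚᵘ ε ℚᵘ.* toℚᵘ (ι (suc d))                ≃⟨ ℚ.toℚᵘ-homo-* ε (ι (suc d)) ⟨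
  toℚᵘ (ε * ι (suc d))                        ∎)
  where
  open ℚᵘ.≤-Reasoning
  le : 1 ℕ.* (suc d ℕ.* 1) ℕ.≤ suc n ℕ.* suc d ℕ.* 1
  le = ℕ.≤-trans (ℕ.*-monoˡ-≤ (suc d ℕ.* 1) (ℕ.s≤s (ℕ.z≤n {n})))
         (ℕ.≤-reflexive (sym (ℕ.*-assoc (suc n) (suc d) 1)))

-- 3 - ε ≤ (3 d - 1) / d for large d, written with suc d in place of d.
base-bound : ∀ ε → 0ℚ < ε → ∃ λ d → (ι 3 - ε) * ι (suc d) ℚ.≤ ι (2 ℕ.+ 3 ℕ.* d)
base-bound ε 0<ε with d , le ← archimedean ε 0<ε = d , (begin
  (ι 3 - ε) * δ                    ≡⟨ ℚ.*-distribʳ-+ δ (ι 3) (ℚ.- ε) ⟩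
  ι 3 * δ ℚ.+ (ℚ.- ε) * δ          ≡⟨ cong (ι 3 * δ ℚ.+_) (ℚ.neg-distribˡ-* ε δ) ⟨
  ι 3 * δ - ε * δ                  ≤⟨ ℚ.+-monoʳ-≤ (ι 3 * δ) (ℚ.neg-antimono-≤ le) ⟩
  ι 3 * δ - 1ℚ                     ≡⟨ cong (_- 1ℚ) (ι-* 3 (suc d)) ⟨
  ι (3 ℕ.* suc d) - 1ℚ
    ≡⟨ cong (λ n → ι n - 1ℚ) (trans (ℕ.*-suc 3 d) (ℕ.+-comm 1 (2 ℕ.+ 3 ℕ.* d))) ⟩
  ι (2 ℕ.+ 3 ℕ.* d ℕ.+ 1) - 1ℚ     ≡⟨ cong (_- 1ℚ) (ι-+ (2 ℕ.+ 3 ℕ.* d) 1) ⟩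
  ι (2 ℕ.+ 3 ℕ.* d) ℚ.+ 1ℚ - 1ℚ    ≡⟨ ℚ.+-assoc (ι (2 ℕ.+ 3 ℕ.* d)) 1ℚ (ℚ.- 1ℚ) ⟩
  ι (2 ℕ.+ 3 ℕ.* d) ℚ.+ 0ℚ         ≡⟨ ℚ.+-identityʳ _ ⟩
  ι (2 ℕ.+ 3 ℕ.* d)                ∎)
  where
  open ℚ.≤-Reasoning
  δ = ι (suc d)

^-nonNeg : ∀ q k → 0ℚ ℚ.≤ q → 0ℚ ℚ.≤ q ^ k
^-nonNeg q zero    0≤q = ℚ.nonNegative⁻¹ 1ℚ
^-nonNeg q (suc k) 0≤q =
  ℚ.nonNegative⁻¹ _ {{ℚ.nonNeg*nonNeg⇒nonNeg q {{nonNegative 0≤q}} (q ^ k) {{nonNegative (^-nonNeg q k 0≤q)}}}}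

-- Clearing denominators moves the growth argument from rationals to natural numbers.
^-scaled : ∀ q d D k → 0ℚ ℚ.≤ q → q * ι d ℚ.≤ ι D → q ^ k * ι (d ℕ.^ k) ℚ.≤ ι (D ℕ.^ k)
^-scaled q d D zero    0≤q le = ℚ.≤-refl
^-scaled q d D (suc k) 0≤q le = begin
  q * q ^ k * ι (d ℕ.* d ℕ.^ k)         ≡⟨ cong (q * q ^ k *_) (ι-* d (d ℕ.^ k)) ⟩
  q * q ^ k * (ι d * ι (d ℕ.^ k))       ≡⟨ medial q (q ^ k) (ι d) (ι (d ℕ.^ k)) ⟩
  q * ι d * (q ^ k * ι (d ℕ.^ k))
    ≤⟨ ℚ.*-monoʳ-≤-nonNeg (q ^ k * ι (d ℕ.^ k)) {{ℚ.nonNeg*nonNeg⇒nonNeg (q ^ k) {{nonNegative (^-nonNeg q k 0≤q)}} (ι (d ℕ.^ k)) {{ι-nonNeg (d ℕ.^ k)}}}} le ⟩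
  ι D * (q ^ k * ι (d ℕ.^ k))
    ≤⟨ ℚ.*-monoˡ-≤-nonNeg (ι D) {{ι-nonNeg D}} (^-scaled q d D k 0≤q le) ⟩
  ι D * ι (D ℕ.^ k)                     ≡⟨ ι-* D (D ℕ.^ k) ⟨
  ι (D ℕ.* D ℕ.^ k)                     ∎
  where
  open ℚ.≤-Reasoning
  open import Algebra.Properties.CommutativeSemigroup
    (CommutativeMonoid.commutativeSemigroup ℚ.*-1-commutativeMonoid)
    renaming (interchange to medial)

space-bound : ∀ q d D k C ℓ c → 0ℚ ℚ.≤ q → q * ι d ℚ.≤ ι D → ι c ℚ.≤ ι C * (q ^ k * ι ℓ) →
  c ℕ.* d ℕ.^ k ℕ.≤ C ℕ.* ℓ ℕ.* D ℕ.^ k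
space-bound q d D k C ℓ c 0≤q le bound = ι-cancel-≤ (begin
  ι (c ℕ.* d ℕ.^ k)                         ≡⟨ ι-* c (d ℕ.^ k) ⟩
  ι c * ι (d ℕ.^ k)
    ≤⟨ ℚ.*-monoʳ-≤-nonNeg (ι (d ℕ.^ k)) {{ι-nonNeg (d ℕ.^ k)}} bound ⟩
  ι C * (q ^ k * ι ℓ) * ι (d ℕ.^ k)
    ≡⟨ cong (λ x → ι C * x * ι (d ℕ.^ k)) (ℚ.*-comm (q ^ k) (ι ℓ)) ⟩
  ι C * (ι ℓ * q ^ k) * ι (d ℕ.^ k)         ≡⟨ cong (_* ι (d ℕ.^ k)) (ℚ.*-assoc (ι C) (ι ℓ) (q ^ k)) ⟨
  ι C * ι ℓ * q ^ k * ι (d ℕ.^ k)           ≡⟨ ℚ.*-assoc (ι C * ι ℓ) (q ^ k) (ι (d ℕ.^ k)) ⟩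
  ι C * ι ℓ * (q ^ k * ι (d ℕ.^ k))         ≡⟨ cong (_* (q ^ k * ι (d ℕ.^ k))) (ι-* C ℓ) ⟨
  ι (C ℕ.* ℓ) * (q ^ k * ι (d ℕ.^ k))
    ≤⟨ ℚ.*-monoˡ-≤-nonNeg (ι (C ℕ.* ℓ)) {{ι-nonNeg (C ℕ.* ℓ)}} (^-scaled q d D k 0≤q le) ⟩
  ι (C ℕ.* ℓ) * ι (D ℕ.^ k)                 ≡⟨ ι-* (C ℕ.* ℓ) (D ℕ.^ k) ⟨
  ι (C ℕ.* ℓ ℕ.* D ℕ.^ k)                   ∎)
  where open ℚ.≤-Reasoning

even-power : ∀ q j → q ℚ.≤ 0ℚ → 0ℚ ℚ.≤ q ^ (j ℕ.* 2)
even-power q zero    q≤0 = ℚ.nonNegative⁻¹ 1ℚ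
even-power q (suc j) q≤0 =
  ℚ.nonNegative⁻¹ _ {{ℚ.nonPos*nonPos⇒nonPos q {{nonPositive q≤0}} (q * p) {{odd}}}}
  where
  p = q ^ (j ℕ.* 2)
  odd = ℚ.nonPos*nonNeg⇒nonPos q {{nonPositive q≤0}} p {{nonNegative (even-power q j q≤0)}}

-- An odd power of a nonpositive number is nonpositive, which leaves no room for a single cell.
odd-power-bound : ∀ q j C ℓ c → q ℚ.≤ 0ℚ → ι c ℚ.≤ ι C * (q ^ (1 ℕ.+ j ℕ.* 2) * ι ℓ) → c ≡ 0
odd-power-bound q j C ℓ c q≤0 bound = ℕ.n≤0⇒n≡0 (ι-cancel-≤ (ℚ.≤-trans bound
  (ℚ.nonPositive⁻¹ _ {{ℚ.nonNeg*nonPos⇒nonPos (ι C) {{ι-nonNeg C}} (q * p * ι ℓ)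
    {{ℚ.nonPos*nonNeg⇒nonPos (q * p) {{odd}} (ι ℓ) {{ι-nonNeg ℓ}}}}}})))
  where
  p = q ^ (j ℕ.* 2)
  odd = ℚ.nonPos*nonNeg⇒nonPos q {{nonPositive q≤0}} p {{nonNegative (even-power q j q≤0)}}

-- Growth

n≤2^n : ∀ n → n ℕ.≤ 2 ℕ.^ n
n≤2^n zero    = z≤n
n≤2^n (suc n) = begin
  suc n         ≤⟨ ℕ.+-mono-≤ (ℕ.m^n>0 2 n) (n≤2^n n) ⟩
  2 ℕ.^ n + 2 ℕ.^ n ≡⟨ cong (_+_ (2 ℕ.^ n)) (ℕ.+-identityʳ (2 ℕ.^ n)) ⟨
  2 ℕ.^ suc n     ∎
  where open ℕ.≤-Reasoning

-- (1 + 1/D)^t ≥ t/D, cleared of denominators.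
bernoulli : ∀ D t → t ℕ.* D ℕ.^ t ℕ.≤ D ℕ.* (1 + D) ℕ.^ t
bernoulli D zero    = z≤n
bernoulli D (suc t) = begin
  suc t ℕ.* (D ℕ.* D ℕ.^ t)                                ≡⟨ expand t D (D ℕ.^ t) ⟩
  D ℕ.* D ℕ.^ t + D ℕ.* (t ℕ.* D ℕ.^ t)
    ≤⟨ ℕ.+-mono-≤ (ℕ.*-monoʳ-≤ D (ℕ.^-monoˡ-≤ t (ℕ.n≤1+n D))) (ℕ.*-monoʳ-≤ D (bernoulli D t)) ⟩
  D ℕ.* (1 + D) ℕ.^ t + D ℕ.* (D ℕ.* (1 + D) ℕ.^ t)          ≡⟨ collect D ((1 + D) ℕ.^ t) ⟩
  D ℕ.* ((1 + D) ℕ.* (1 + D) ℕ.^ t)                        ∎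
  where
  open ℕ.≤-Reasoning
  expand : ∀ t D x → suc t ℕ.* (D ℕ.* x) ≡ D ℕ.* x + D ℕ.* (t ℕ.* x)
  expand = solve-∀
  collect : ∀ D y → D ℕ.* y + D ℕ.* (D ℕ.* y) ≡ D ℕ.* ((1 + D) ℕ.* y)
  collect = solve-∀

-- The fourth power of `bernoulli`: a quartic factor is enough to outgrow the quadratic one in
-- `growth`.
bernoulli⁴ : ∀ D t → t ℕ.^ 4 ℕ.* D ℕ.^ (t ℕ.* 4) ℕ.≤ D ℕ.^ 4 ℕ.* (1 + D) ℕ.^ (t ℕ.* 4)
bernoulli⁴ D t = begin
  t ℕ.^ 4 ℕ.* D ℕ.^ (t ℕ.* 4)          ≡⟨ cong (t ℕ.^ 4 ℕ.*_) (ℕ.^-*-assoc D t 4) ⟨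
  t ℕ.^ 4 ℕ.* (D ℕ.^ t) ℕ.^ 4            ≡⟨ fourth t (D ℕ.^ t) ⟨
  (t ℕ.* D ℕ.^ t) ℕ.^ 4                ≤⟨ ℕ.^-monoˡ-≤ 4 (bernoulli D t) ⟩
  (D ℕ.* (1 + D) ℕ.^ t) ℕ.^ 4          ≡⟨ fourth D ((1 + D) ℕ.^ t) ⟩
  D ℕ.^ 4 ℕ.* ((1 + D) ℕ.^ t) ℕ.^ 4      ≡⟨ cong (D ℕ.^ 4 ℕ.*_) (ℕ.^-*-assoc (1 + D) t 4) ⟩
  D ℕ.^ 4 ℕ.* (1 + D) ℕ.^ (t ℕ.* 4)    ∎
  where
  open ℕ.≤-Reasoning
  fourth : ∀ x y → (x ℕ.* y) ℕ.^ 4 ≡ x ℕ.^ 4 ℕ.* y ℕ.^ 4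
  fourth x y = expand x y
    where
    expand : ∀ x y →
      x ℕ.* y ℕ.* (x ℕ.* y ℕ.* (x ℕ.* y ℕ.* (x ℕ.* y ℕ.* 1))) ≡ x ℕ.* (x ℕ.* (x ℕ.* (x ℕ.* 1))) ℕ.* (y ℕ.* (y ℕ.* (y ℕ.* (y ℕ.* 1))))
    expand = solve-∀

^-distribʳ-* : ∀ x y n → (x ℕ.* y) ℕ.^ n ≡ x ℕ.^ n ℕ.* y ℕ.^ n
^-distribʳ-* x y zero    = refl
^-distribʳ-* x y (suc n) =
  trans (cong (x ℕ.* y ℕ.*_) (^-distribʳ-* x y n)) (ℕ.[m*n]*[o*p]≡[m*o]*[n*p] x y (x ℕ.^ n) (y ℕ.^ n))

-- With w = 4 t, 3^w beats (3 - 1/d)^w by a factor t^4, while the other factors are quadratic in t.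
growth : ∀ C e γ κ d t {M s ℓ} → let D = 2 + 3 ℕ.* d; w = t ℕ.* 4 in
  M ℕ.≤ e + (γ ℕ.* s + γ ℕ.* s) → 3 ℕ.^ w ℕ.≤ (1 + w ℕ.* 2) ℕ.* M →
  s ℕ.* suc d ℕ.^ (κ + w) ℕ.≤ C ℕ.* ℓ ℕ.* D ℕ.^ (κ + w) → ℓ ℕ.≤ 12 + 8 ℕ.* w →
  t ℕ.* t ℕ.≤ 9 ℕ.* (e + 88 ℕ.* (γ ℕ.* C)) ℕ.* D ℕ.^ (4 + κ)
growth C e γ κ d zero                  _  _  _  _  = z≤n
growth C e γ κ d t@(suc _) {M} {s} {ℓ} hM h3 hs hℓ =
  -- Two factors are inserted to be cancelled: `D ^ w` matches `bernoulli⁴`, and `t * t` absorbs the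
  -- quadratic factor of the upper bound.
  ℕ.*-cancelʳ-≤ (t ℕ.* t) _ (t ℕ.* t) (ℕ.*-cancelʳ-≤ _ _ (D ℕ.^ w) {{ℕ.m^n≢0 D w}} (begin
    t ℕ.* t ℕ.* (t ℕ.* t) ℕ.* D ℕ.^ w              ≡⟨ cong (ℕ._* D ℕ.^ w) (fourth t) ⟩
    t ℕ.^ 4 ℕ.* D ℕ.^ w                              ≤⟨ bernoulli⁴ D t ⟩
    D ℕ.^ 4 ℕ.* (1 + D) ℕ.^ w                        ≤⟨ ℕ.*-monoʳ-≤ (D ℕ.^ 4) upper ⟩
    D ℕ.^ 4 ℕ.* ((1 + w ℕ.* 2) ℕ.* (e + 2 ℕ.* (γ ℕ.* (C ℕ.* ℓ))) ℕ.* D ℕ.^ (κ + w))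
      ≤⟨ ℕ.*-monoʳ-≤ (D ℕ.^ 4) (ℕ.*-monoˡ-≤ (D ℕ.^ (κ + w)) quadratic) ⟩
    D ℕ.^ 4 ℕ.* (9 ℕ.* (e + 88 ℕ.* (γ ℕ.* C)) ℕ.* (t ℕ.* t) ℕ.* D ℕ.^ (κ + w))
      ≡⟨ cong (λ x → D ℕ.^ 4 ℕ.* (9 ℕ.* (e + 88 ℕ.* (γ ℕ.* C)) ℕ.* (t ℕ.* t) ℕ.* x)) (ℕ.^-distribˡ-+-* D κ w) ⟩
    D ℕ.^ 4 ℕ.* (9 ℕ.* (e + 88 ℕ.* (γ ℕ.* C)) ℕ.* (t ℕ.* t) ℕ.* (D ℕ.^ κ ℕ.* D ℕ.^ w))
      ≡⟨ rearrange (D ℕ.^ 4) (9 ℕ.* (e + 88 ℕ.* (γ ℕ.* C))) (t ℕ.* t) (D ℕ.^ κ) (D ℕ.^ w) ⟩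
    9 ℕ.* (e + 88 ℕ.* (γ ℕ.* C)) ℕ.* (D ℕ.^ 4 ℕ.* D ℕ.^ κ) ℕ.* (t ℕ.* t) ℕ.* D ℕ.^ w
      ≡⟨ cong (λ x → 9 ℕ.* (e + 88 ℕ.* (γ ℕ.* C)) ℕ.* x ℕ.* (t ℕ.* t) ℕ.* D ℕ.^ w) (ℕ.^-distribˡ-+-* D 4 κ) ⟨
    9 ℕ.* (e + 88 ℕ.* (γ ℕ.* C)) ℕ.* D ℕ.^ (4 + κ) ℕ.* (t ℕ.* t) ℕ.* D ℕ.^ w ∎))
  where
  open ℕ.≤-Reasoning
  D = 2 + 3 ℕ.* d
  w = t ℕ.* 4
  δ = suc d
  P = δ ℕ.^ (κ + w)
  X = D ℕ.^ (κ + w)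

  rearrange : ∀ a b c f g → a ℕ.* (b ℕ.* c ℕ.* (f ℕ.* g)) ≡ b ℕ.* (a ℕ.* f) ℕ.* c ℕ.* g
  rearrange = solve-∀

  fourth : ∀ t → t ℕ.* t ℕ.* (t ℕ.* t) ≡ t ℕ.^ 4
  fourth t = expand t
    where
    expand : ∀ t → t ℕ.* t ℕ.* (t ℕ.* t) ≡ t ℕ.* (t ℕ.* (t ℕ.* (t ℕ.* 1)))
    expand = solve-∀

  3δ : 1 + D ≡ 3 ℕ.* δ
  3δ = sym (ℕ.*-suc 3 d)

  δ≤D : δ ℕ.≤ D
  δ≤D = ℕ.≤-trans (s≤s (ℕ.m≤n*m d 3)) (ℕ.n≤1+n _)

  -- `3 ^ w` is traded for `M`, `M` for the number `s` of cells, and `s` for the space bound, whose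
  -- denominators `P` clears.
  upper : (1 + D) ℕ.^ w ℕ.≤ (1 + w ℕ.* 2) ℕ.* (e + 2 ℕ.* (γ ℕ.* (C ℕ.* ℓ))) ℕ.* X
  upper = begin
    (1 + D) ℕ.^ w                                      ≡⟨ cong (ℕ._^ w) 3δ ⟩
    (3 ℕ.* δ) ℕ.^ w                                    ≡⟨ ^-distribʳ-* 3 δ w ⟩
    3 ℕ.^ w ℕ.* δ ℕ.^ w
      ≤⟨ ℕ.*-monoʳ-≤ (3 ℕ.^ w) (ℕ.^-monoʳ-≤ δ (ℕ.m≤n+m w κ)) ⟩
    3 ℕ.^ w ℕ.* P                                      ≤⟨ ℕ.*-monoˡ-≤ P h3 ⟩
    (1 + w ℕ.* 2) ℕ.* M ℕ.* P                        ≤⟨ ℕ.*-monoˡ-≤ P (ℕ.*-monoʳ-≤ (1 + w ℕ.* 2) hM) ⟩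
    (1 + w ℕ.* 2) ℕ.* (e + (γ ℕ.* s + γ ℕ.* s)) ℕ.* P ≡⟨ spread (1 + w ℕ.* 2) e γ s P ⟩
    (1 + w ℕ.* 2) ℕ.* (e ℕ.* P + 2 ℕ.* (γ ℕ.* (s ℕ.* P)))
      ≤⟨ ℕ.*-monoʳ-≤ (1 + w ℕ.* 2) (ℕ.+-mono-≤ (ℕ.*-monoʳ-≤ e (ℕ.^-monoˡ-≤ (κ + w) δ≤D)) (ℕ.*-monoʳ-≤ 2 (ℕ.*-monoʳ-≤ γ hs))) ⟩
    (1 + w ℕ.* 2) ℕ.* (e ℕ.* X + 2 ℕ.* (γ ℕ.* (C ℕ.* ℓ ℕ.* X)))
      ≡⟨ gather (1 + w ℕ.* 2) e γ (C ℕ.* ℓ) X ⟩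
    (1 + w ℕ.* 2) ℕ.* (e + 2 ℕ.* (γ ℕ.* (C ℕ.* ℓ))) ℕ.* X ∎
    where
    spread : ∀ a e γ s P →
      a ℕ.* (e + (γ ℕ.* s + γ ℕ.* s)) ℕ.* P ≡ a ℕ.* (e ℕ.* P + 2 ℕ.* (γ ℕ.* (s ℕ.* P)))
    spread = solve-∀
    gather : ∀ a e γ c X → a ℕ.* (e ℕ.* X + 2 ℕ.* (γ ℕ.* (c ℕ.* X))) ≡ a ℕ.* (e + 2 ℕ.* (γ ℕ.* c)) ℕ.* X
    gather = solve-∀

  -- For `t` at least one, `1 + 2w` is at most `9t` and `ℓ` at most `12t + 32t = 44t`; 88 is twice
  -- 44.
  quadratic : (1 + w ℕ.* 2) ℕ.* (e + 2 ℕ.* (γ ℕ.* (C ℕ.* ℓ))) ℕ.≤ 9 ℕ.* (e + 88 ℕ.* (γ ℕ.* C)) ℕ.* (t ℕ.* t)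
  quadratic = begin
    (1 + w ℕ.* 2) ℕ.* (e + 2 ℕ.* (γ ℕ.* (C ℕ.* ℓ)))
      ≤⟨ ℕ.*-mono-≤ (ℕ.+-monoˡ-≤ (w ℕ.* 2) (s≤s (z≤n {ℕ.pred t}))) (ℕ.+-mono-≤ (ℕ.m≤m*n e t) (ℕ.*-monoʳ-≤ 2 (ℕ.*-monoʳ-≤ γ (ℕ.*-monoʳ-≤ C linear)))) ⟩
    (t + w ℕ.* 2) ℕ.* (e ℕ.* t + 2 ℕ.* (γ ℕ.* (C ℕ.* (44 ℕ.* t)))) ≡⟨ collect t e γ C ⟩
    9 ℕ.* (e + 88 ℕ.* (γ ℕ.* C)) ℕ.* (t ℕ.* t) ∎
    where
    collect : ∀ t e γ C →
      (t + t ℕ.* 4 ℕ.* 2) ℕ.* (e ℕ.* t + 2 ℕ.* (γ ℕ.* (C ℕ.* (44 ℕ.* t)))) ≡ 9 ℕ.* (e + 88 ℕ.* (γ ℕ.* C)) ℕ.* (t ℕ.* t)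
    collect = solve-∀
    linear : ℓ ℕ.≤ 44 ℕ.* t
    linear = begin
      ℓ                              ≤⟨ hℓ ⟩
      12 + 8 ℕ.* w                   ≤⟨ ℕ.+-monoˡ-≤ (8 ℕ.* w) (ℕ.m≤m*n 12 t) ⟩
      12 ℕ.* t + 8 ℕ.* (t ℕ.* 4)     ≡⟨ add t ⟩
      44 ℕ.* t                       ∎
      where
      add : ∀ t → 12 ℕ.* t + 8 ℕ.* (t ℕ.* 4) ≡ 44 ℕ.* t
      add = solve-∀

-- There are at most `3 ^ w * (12 + 6 * w)` vertices; `3 ^ w` is rounded up to `4 ^ w` and the
-- linear factor to a power of two.
log-order : ∀ {M w} → M ℕ.≤ 3 ℕ.^ w → ⌈log₂ Vertices.order M (suc w) ⌉ ℕ.≤ 12 + 8 ℕ.* w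
log-order {M} {w} small = begin
  ⌈log₂ order ⌉                            ≤⟨ ⌈log₂⌉-mono-≤ bound ⟩
  ⌈log₂ 2 ℕ.^ (12 + 8 ℕ.* w) ⌉               ≡⟨ ⌈log₂2^n⌉≡n (12 + 8 ℕ.* w) ⟩
  12 + 8 ℕ.* w                             ∎
  where
  open ℕ.≤-Reasoning
  open Vertices M (suc w)
  bound : order ℕ.≤ 2 ℕ.^ (12 + 8 ℕ.* w)
  bound = begin
    order                                  ≡⟨ arrange w M ⟩
    1 ℕ.* (5 + 3 ℕ.* w) + M ℕ.* (7 + 3 ℕ.* w)
      ≤⟨ ℕ.+-mono-≤ (ℕ.*-monoˡ-≤ (5 + 3 ℕ.* w) (ℕ.m^n>0 3 w)) (ℕ.*-monoˡ-≤ (7 + 3 ℕ.* w) small) ⟩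
    3 ℕ.^ w ℕ.* (5 + 3 ℕ.* w) + 3 ℕ.^ w ℕ.* (7 + 3 ℕ.* w) ≡⟨ collect w (3 ℕ.^ w) ⟩
    3 ℕ.^ w ℕ.* (12 + 6 ℕ.* w)
      ≤⟨ ℕ.*-mono-≤ (ℕ.^-monoˡ-≤ w (ℕ.n≤1+n 3)) (n≤2^n (12 + 6 ℕ.* w)) ⟩
    4 ℕ.^ w ℕ.* 2 ℕ.^ (12 + 6 ℕ.* w)           ≡⟨ cong (ℕ._* 2 ℕ.^ (12 + 6 ℕ.* w)) (ℕ.^-*-assoc 2 2 w) ⟩
    2 ℕ.^ (2 ℕ.* w) ℕ.* 2 ℕ.^ (12 + 6 ℕ.* w)   ≡⟨ ℕ.^-distribˡ-+-* 2 (2 ℕ.* w) (12 + 6 ℕ.* w) ⟨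
    2 ℕ.^ (2 ℕ.* w + (12 + 6 ℕ.* w))         ≡⟨ cong (2 ℕ.^_) (add w) ⟩
    2 ℕ.^ (12 + 8 ℕ.* w)                     ∎
    where
    arrange : ∀ w M →
      suc w + (2 + (M ℕ.* (4 + suc w ℕ.* 3) + suc w ℕ.* 2)) ≡ 1 ℕ.* (5 + 3 ℕ.* w) + M ℕ.* (7 + 3 ℕ.* w)
    arrange = solve-∀
    collect : ∀ w x → x ℕ.* (5 + 3 ℕ.* w) + x ℕ.* (7 + 3 ℕ.* w) ≡ x ℕ.* (12 + 6 ℕ.* w)
    collect = solve-∀
    add : ∀ w → 2 ℕ.* w + (12 + 6 ℕ.* w) ≡ 12 + 8 ℕ.* w
    add = solve-∀

-- With a power of two on the right, comparing with `2 ^ M` becomes a comparison of exponents.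
outcomes-exponent : ∀ {alphabet} (T : DPTM alphabet) s → let open DPTM T in
  Fooling.outcomeCount T s ℕ.≤
    2 ℕ.^ ((2 + states ℕ.* suc symbols) + ((2 + symbols) ℕ.* s + (2 + symbols) ℕ.* s))
outcomes-exponent T s = begin
  2 + states ℕ.* (suc symbols ℕ.* (γ ℕ.^ s ℕ.* γ ℕ.^ s))
    ≤⟨ ℕ.+-monoˡ-≤ _ (ℕ.*-monoʳ-≤ 2 (ℕ.*-mono-≤ (ℕ.m^n>0 γ s) (ℕ.m^n>0 γ s))) ⟩
  2 ℕ.* (γ ℕ.^ s ℕ.* γ ℕ.^ s) + states ℕ.* (suc symbols ℕ.* (γ ℕ.^ s ℕ.* γ ℕ.^ s))
    ≡⟨ collect states (suc symbols) (γ ℕ.^ s ℕ.* γ ℕ.^ s) ⟩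
  e ℕ.* (γ ℕ.^ s ℕ.* γ ℕ.^ s)
    ≤⟨ ℕ.*-mono-≤ (n≤2^n e) (ℕ.*-mono-≤ power power) ⟩
  2 ℕ.^ e ℕ.* (2 ℕ.^ (γ ℕ.* s) ℕ.* 2 ℕ.^ (γ ℕ.* s))
    ≡⟨ cong (2 ℕ.^ e ℕ.*_) (ℕ.^-distribˡ-+-* 2 (γ ℕ.* s) (γ ℕ.* s)) ⟨
  2 ℕ.^ e ℕ.* 2 ℕ.^ (γ ℕ.* s + γ ℕ.* s)
    ≡⟨ ℕ.^-distribˡ-+-* 2 e (γ ℕ.* s + γ ℕ.* s) ⟨
  2 ℕ.^ (e + (γ ℕ.* s + γ ℕ.* s))                            ∎
  where
  open ℕ.≤-Reasoning
  open DPTM T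
  γ = 2 + symbols
  e = 2 + states ℕ.* suc symbols
  collect : ∀ a b y → 2 ℕ.* y + a ℕ.* (b ℕ.* y) ≡ (2 + a ℕ.* b) ℕ.* y
  collect = solve-∀
  power : γ ℕ.^ s ℕ.≤ 2 ℕ.^ (γ ℕ.* s)
  power = ℕ.≤-trans (ℕ.^-monoˡ-≤ s (n≤2^n γ)) (ℕ.≤-reflexive (ℕ.^-*-assoc 2 γ s))

someWord : ∀ w M → 3 ℕ.^ w ℕ.≤ (1 + w ℕ.* 2) ℕ.* M → Fin M
someWord w zero    le = contradiction
  (ℕ.≤-trans (ℕ.m^n>0 3 w) (ℕ.≤-trans le (ℕ.≤-reflexive (ℕ.*-zeroʳ (1 + w ℕ.* 2))))) λ ()
someWord w (suc M) le = zero

-- The space bound applied to the family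

SpaceWithin : ∀ {τ} (E : Encoding τ) → DPTM (Encoding.alphabet E) → ℚ → ℕ → ℕ → Set
SpaceWithin {τ} E T q C N = (I : Instance τ) → let open Instance I in N ℕ.≤ k → N ℕ.≤ size →
  Run.SpaceAtMost T (Encoding.encode E I) (ι C * (q ^ k * log size))

module _ {τ} (E : Encoding τ) (T : DPTM (Encoding.alphabet E)) (solves : Solves E T DominatingSet)
         (q : ℚ) (C N : ℕ) (space : SpaceWithin E T q C N)
         (w : ℕ) (N≤w : N ℕ.≤ w) where
  open Code (constantWeight w)

  private
    word : Fin M
    word = someWord w M large

  open Family code word
  open Gadgets code using (order)
  open Run T

  ℓ : ℕ
  ℓ = ⌈log₂ order ⌉

  kᵗ : ℕ
  kᵗ = overhead τ + w

  cells-bound : ∀ L c → initial (Encoding.encode E (inst L (code word) τ)) ⟶* c →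
    ι (Tape.cells (Config.work c)) ℚ.≤ ι C * (q ^ kᵗ * ι ℓ)
  cells-bound L c run =
    subst₂ (λ k n → ι (Tape.cells (Config.work c)) ℚ.≤ ι C * (q ^ k * log n))
      (k-inst τ L (code word)) (size-inst τ L (code word))
      (space (inst L (code word) τ)
        (ℕ.≤-trans N≤w (ℕ.≤-trans (ℕ.m≤n+m w (overhead τ)) (ℕ.≤-reflexive (sym (k-inst τ L (code word))))))
        (ℕ.≤-trans (ℕ.≤-trans N≤w (ℕ.≤-trans (ℕ.n≤1+n w) (ℕ.m≤m+n (suc w) _))) (ℕ.≤-reflexive (sym (size-inst τ L (code word)))))
        c run)

  -- The initial configuration already occupies one cell.
  odd-width-impossible : q ℚ.≤ 0ℚ → ∀ j → kᵗ ≢ 1 + j ℕ.* 2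
  odd-width-impossible q≤0 j odd = contradiction
    (odd-power-bound q j C ℓ 1 q≤0 (subst (λ k → ι 1 ℚ.≤ ι C * (q ^ k * ι ℓ)) odd (cells-bound (λ _ → false) _ Star.ε)))
    λ ()

  dimension-bound : ∀ d D → 0ℚ ℚ.≤ q → q * ι (suc d) ℚ.≤ ι D → ∃ λ s →
    M ℕ.≤ (2 + DPTM.states T ℕ.* suc (DPTM.symbols T)) + ((2 + DPTM.symbols T) ℕ.* s + (2 + DPTM.symbols T) ℕ.* s)
      × s ℕ.* suc d ℕ.^ kᵗ ℕ.≤ C ℕ.* ℓ ℕ.* D ℕ.^ kᵗ
  dimension-bound d D 0≤q le = s , ℕ.≮⇒≥ (λ lt → ℕ.<⇒≱ (ℕ.^-monoʳ-< 2 (s≤s (s≤s z≤n)) lt) exponential)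
    , m/n*n≤m (C ℕ.* ℓ ℕ.* D ℕ.^ kᵗ) (suc d ℕ.^ kᵗ)
    where
    instance
      nonZero : ℕ.NonZero (suc d ℕ.^ kᵗ)
      nonZero = ℕ.m^n≢0 (suc d) kᵗ

    s : ℕ
    -- The space bound rounded down; a number of cells is an integer, so nothing is lost.
    s = C ℕ.* ℓ ℕ.* D ℕ.^ kᵗ ℕ./ suc d ℕ.^ kᵗ

    exponential : 2 ℕ.^ M ℕ.≤ 2 ℕ.^ ((2 + DPTM.states T ℕ.* suc (DPTM.symbols T)) + ((2 + DPTM.symbols T) ℕ.* s + (2 + DPTM.symbols T) ℕ.* s))
    exponential = ℕ.≤-trans (2^M≤outcomes E antichain lft-first T solves s λ L c run →
        ℕ.≤-trans (ℕ.≤-reflexive (sym (m*n/n≡m (Tape.cells (Config.work c)) (suc d ℕ.^ kᵗ))))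
          (/-monoˡ-≤ (suc d ℕ.^ kᵗ) (space-bound q (suc d) D kᵗ C ℓ (Tape.cells (Config.work c)) 0≤q le (cells-bound L c run))))
      (outcomes-exponent T s)

  ℓ-bound : ℓ ℕ.≤ 12 + 8 ℕ.* w
  ℓ-bound = log-order {w = w} small

-- `w` is at least `N` and makes the width or depth odd: `9 + 2N` for trees and paths, `11 + 2N` for
-- treedepth.
nonpositive-base : ∀ {τ} (E : Encoding τ) T → Solves E T DominatingSet → ∀ q C N →
  SpaceWithin E T q C N → ¬ q ℚ.≤ 0ℚ
nonpositive-base {tree}      E T solves q C N space q≤0 =
  odd-width-impossible E T solves q C N space (N ℕ.* 2) (ℕ.m≤m*n N 2) q≤0 (4 + N) refl
nonpositive-base {path}      E T solves q C N space q≤0 =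
  odd-width-impossible E T solves q C N space (N ℕ.* 2) (ℕ.m≤m*n N 2) q≤0 (4 + N) refl
nonpositive-base {treedepth} E T solves q C N space q≤0 =
  odd-width-impossible E T solves q C N space (1 + N ℕ.* 2) (ℕ.m≤n⇒m≤1+n (ℕ.m≤m*n N 2)) q≤0 (5 + N) refl

nonnegative-base : ∀ {τ} (E : Encoding τ) T → Solves E T DominatingSet → ∀ q C N →
  SpaceWithin E T q C N → ∀ d → q * ι (suc d) ℚ.≤ ι (2 + 3 ℕ.* d) → ¬ 0ℚ ℚ.≤ q
nonnegative-base {τ} E T solves q C N space d le 0≤q =
  ℕ.<⇒≱ (ℕ.≤-trans (s≤s (ℕ.m≤m+n K N)) (ℕ.m≤m*n t t)) bound
  where
  open DPTM T
  e = 2 + states ℕ.* suc symbols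
  γ = 2 + symbols
  κ = overhead τ
  -- `K` is the bound on `t * t` from `growth`. A `t` above `K` violates it, and a `t` above `N`
  -- makes the instance large enough for the space bound to apply.
  K = 9 ℕ.* (e + 88 ℕ.* (γ ℕ.* C)) ℕ.* (2 + 3 ℕ.* d) ℕ.^ (4 + κ)
  t = suc (K + N)
  w = t ℕ.* 4

  N≤w : N ℕ.≤ w
  N≤w = ℕ.≤-trans (ℕ.m≤n+m N (suc K)) (ℕ.m≤m*n t 4)

  bound : t ℕ.* t ℕ.≤ K
  bound = let s , hM , hs = dimension-bound E T solves q C N space w N≤w d (2 + 3 ℕ.* d) 0≤q le in
    growth C e γ κ d t {s = s} hM (Code.large (constantWeight w)) hs
      (ℓ-bound E T solves q C N space w N≤w)

theorem3p6 : ∀ (τ : Kind) (E : Encoding τ) (ε : ℚ) → 0ℚ < ε →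
    ¬ (∃ λ (M : DPTM (Encoding.alphabet E)) →
    Solves E M DominatingSet
    × SpaceO E M (λ k n → ((+ 3 / 1) - ε) ^ k * log n))
theorem3p6 τ E ε 0<ε (T , solves , C , N , space) =
  [ (let d , le = base-bound ε 0<ε in nonnegative-base E T solves (ι 3 - ε) C N space d le)
  , nonpositive-base E T solves (ι 3 - ε) C N space
  ]′ (ℚ.≤-total 0ℚ (ι 3 - ε))
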